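{- As an identity of formal power series in $x,y,q$, \begin{align*} \frac{1}{(xq;q^2)_\infty (yq^2;q^4)_\infty} = \sum_{n_1,n_2,n_3,n_4\ge 0}\frac{x^{n_1+n_2+2n_4}y^{n_2+n_3}q^{n_1+3n_2+2n_3+2n_4}\left(1+x^2yq^{4+4(n_1+n_3)}\right)}{(q^2;q^2)_{n_1}(q^2;q^2)_{n_2}(q^4;q^4)_{n_3}(q^4;q^4)_{n_4}}\, q^{2\binom{n_1}{2}+2n_1n_2+4n_1n_3+4n_3n_4}. \end{align*}
   Context: For $n\in\mathbb{N}\cup\{\infty\}$, $(A;q)_n:=\prod_{k=0}^{n-1}(1-Aq^k)$. -}

module Defs where

open import Data.Nat as ℕ using (ℕ; zero; suc; _≡ᵇ_)
open import Data.Nat.Combinatorics using (_C_)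
open import Data.Integer as ℤ using (ℤ; +_)
open import Relation.Binary.PropositionalEquality using (_≡_)
open import Data.Bool using (Bool; true; false; _∧_; if_then_else_)

-- Formal power series in three commuting variables x, y, q with integer
-- coefficients:  F i j k  is the coefficient of  x^i y^j q^k.
FPS : Set
FPS = ℕ → ℕ → ℕ → ℤ

_≐_ : FPS → FPS → Set
F ≐ G = ∀ i j k → F i j k ≡ G i j k
infix 4 _≐_

sumTo : ℕ → (ℕ → ℤ) → ℤ
sumTo zero    h = h zero
sumTo (suc n) h = sumTo n h ℤ.+ h (suc n)

ind : Bool → ℤ
ind true  = + 1
ind false = + 0

one : FPS
one i j k = ind ((i ≡ᵇ 0) ∧ (j ≡ᵇ 0) ∧ (k ≡ᵇ 0))

mono : ℕ → ℕ → ℕ → FPS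
mono a b c i j k = ind ((i ≡ᵇ a) ∧ (j ≡ᵇ b) ∧ (k ≡ᵇ c))

_⊕_ : FPS → FPS → FPS
(F ⊕ G) i j k = F i j k ℤ.+ G i j k
infixl 6 _⊕_

_⊗_ : FPS → FPS → FPS
(F ⊗ G) i j k =
  sumTo i λ a → sumTo j λ b → sumTo k λ c →
    F a b c ℤ.* G (i ℕ.∸ a) (j ℕ.∸ b) (k ℕ.∸ c)
infixl 7 _⊗_

-- geometric series 1/(1 - x^a y^b q^c) = Σ_{m≥0} x^{am} y^{bm} q^{cm},
-- used only with c ≥ 1 (then any m with cm = k satisfies m ≤ k, and m is unique).
geom : ℕ → ℕ → ℕ → FPS
geom a b c i j k =
  sumTo k λ m → ind ((i ≡ᵇ a ℕ.* m) ∧ (j ≡ᵇ b ℕ.* m) ∧ (k ≡ᵇ c ℕ.* m))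

invPoch : ℕ → ℕ → ℕ → ℕ → ℕ → FPS
invPoch a b e d zero    = one
invPoch a b e d (suc n) = invPoch a b e d n ⊗ geom a b (e ℕ.+ d ℕ.* n)

-- 1 / (x^a y^b q^e ; q^d)_∞ for e, d ≥ 1: the coefficient of q^k only
-- depends on the factors with t ≤ k (all later factors are 1 + O(q^{k+1})),
-- so it is the coefficient of the truncated product with k+1 factors.
invPochInf : ℕ → ℕ → ℕ → ℕ → FPS
invPochInf a b e d i j k = invPoch a b e d (suc k) i j k

-- Σ_{n1,n2,n3,n4 ≥ 0} T n1 n2 n3 n4  for a family whose term T n has
-- q-adic order ≥ n1+n2+n3+n4: the coefficient of q^k only receives
-- contributions from indices n_i ≤ k.
sum4 : (ℕ → ℕ → ℕ → ℕ → FPS) → FPS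
sum4 T i j k =
  sumTo k λ n₁ → sumTo k λ n₂ → sumTo k λ n₃ → sumTo k λ n₄ → T n₁ n₂ n₃ n₄ i j k

LHS : FPS
LHS = invPochInf 1 0 1 2 ⊗ invPochInf 0 1 2 4

term : ℕ → ℕ → ℕ → ℕ → FPS
term n₁ n₂ n₃ n₄ =
  mono (n₁ ℕ.+ n₂ ℕ.+ 2 ℕ.* n₄) (n₂ ℕ.+ n₃)
       (n₁ ℕ.+ 3 ℕ.* n₂ ℕ.+ 2 ℕ.* n₃ ℕ.+ 2 ℕ.* n₄
         ℕ.+ (2 ℕ.* (n₁ C 2) ℕ.+ 2 ℕ.* n₁ ℕ.* n₂ ℕ.+ 4 ℕ.* n₁ ℕ.* n₃ ℕ.+ 4 ℕ.* n₃ ℕ.* n₄))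
  ⊗ (one ⊕ mono 2 1 (4 ℕ.+ 4 ℕ.* (n₁ ℕ.+ n₃)))
  ⊗ invPoch 0 0 2 2 n₁ ⊗ invPoch 0 0 2 2 n₂
  ⊗ invPoch 0 0 4 4 n₃ ⊗ invPoch 0 0 4 4 n₄

RHS : FPS
RHS = sum4 term

{-# OPTIONS --safe #-}

-- Both sides have x^i y^j-coefficient q^i/(q²;q²)_i · q^{2j}/(q⁴;q⁴)_j.  On the left this
-- is Euler's expansion.  For the right-hand side S(x), write T(t₁,t₂,t₃,t₄) for the
-- quadruple sum without the factor 1 + x²yq^{4+4(n₁+n₃)} and with linear exponent
-- t₁n₁+t₂n₂+t₃n₃+t₄n₄ of q, so that S = T(1,3,2,2) + x²yq⁴ T(5,3,6,2).  Replacing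
-- 1/(q^d;q^d)_n by 1/(q^d;q^d)_{n-1} + q^{dn}/(q^d;q^d)_n for one summation index at a
-- time gives four contiguous relations,
--   T(t) = T(t₁+2,t₂,t₃,t₄) + x q^{t₁}  T(t₁+2,t₂+2,t₃+4,t₄)
--        = T(t₁,t₂+2,t₃,t₄) + xy q^{t₂} T(t₁+2,t₂,t₃,t₄)
--        = T(t₁,t₂,t₃+4,t₄) + y q^{t₃}  T(t₁+4,t₂,t₃,t₄+4)
--        = T(t₁,t₂,t₃,t₄+4) + x² q^{t₄} T(t₁,t₂,t₃+4,t₄),
-- and a combination of eight instances is S(x) = xq S(x) + S(xq²).  This determines S
-- from its x⁰-part, which is the sum over n₃ alone.

module Submission where

open import Algebra.Bundles using (CommutativeSemiring)
open import Algebra.Structures.Biased using (isCommutativeSemiringˡ)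
open import Data.Bool using (true; false; _∧_)
open import Data.Bool.Properties using (∧-zeroʳ)
open import Data.Integer as ℤ using (ℤ; +_)
import Data.Integer.Properties as ℤₚ
open import Data.Integer.Solver using (module +-*-Solver)
open import Data.Nat as ℕ
  using (ℕ; zero; suc; _≤_; _<_; z≤n; s≤s; s≤s⁻¹; _∸_; _≡ᵇ_; NonZero)
open import Data.Nat.Combinatorics using (_C_; nC1≡n; nCk+nC[k+1]≡[n+1]C[k+1])
import Data.Nat.Properties as ℕₚ
import Data.Nat.Solver
open import Data.Nat.Tactic.RingSolver using (solve-∀)
open import Data.Product using (_,_)
open import Data.Sum using (_⊎_; inj₁; inj₂)
open import Function using (_∘_)
open import Level using (0ℓ)
open import Relation.Binary.Bundles using (Setoid)
open import Relation.Binary.PropositionalEquality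
import Relation.Binary.Reasoning.Setoid as SetoidReasoning
open import Relation.Nullary using (yes; no; contradiction)
open import Defs

-- Integer identities

module ℤ-Identities where

  open +-*-Solver

  +-interchange : ∀ a b c d → (a ℤ.+ b) ℤ.+ (c ℤ.+ d) ≡ (a ℤ.+ c) ℤ.+ (b ℤ.+ d)
  +-interchange = solve 4 (λ a b c d → (a :+ b) :+ (c :+ d) := (a :+ c) :+ (b :+ d)) refl

  *-interchange₃ : ∀ x y z x′ y′ z′ →
    (x ℤ.* (y ℤ.* z)) ℤ.* (x′ ℤ.* (y′ ℤ.* z′)) ≡ (x ℤ.* x′) ℤ.* ((y ℤ.* y′) ℤ.* (z ℤ.* z′))
  *-interchange₃ = solve 6 (λ x y z x′ y′ z′ →
    (x :* (y :* z)) :* (x′ :* (y′ :* z′)) := (x :* x′) :* ((y :* y′) :* (z :* z′))) refl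

  -- The combination of eight contiguous relations that yields S(x) = xq S(x) + S(xq²).
  combine-contiguous : ∀ {r r′ s s′ t t′ u v w m n o k l p} →
    r ≡ s ℤ.+ t → r′ ≡ s′ ℤ.+ t′ → u ≡ v ℤ.+ w → m ≡ n ℤ.+ u →
    o ≡ t ℤ.+ p → k ≡ t′ ℤ.+ l → s′ ≡ o ℤ.+ v → s ≡ m ℤ.+ k →
    r ℤ.+ p ≡ (r′ ℤ.+ l) ℤ.+ (n ℤ.+ w)
  combine-contiguous {t = t} {t′} {v = v} {w} {n = n} {l = l} {p}
    refl refl refl refl refl refl refl refl =
    solve 7 (λ t t′ v w n l p →
      (((n :+ (v :+ w)) :+ (t′ :+ l)) :+ t) :+ p :=
      ((((t :+ p) :+ v) :+ t′) :+ l) :+ (n :+ w)) refl t t′ v w n l p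

open ℤ-Identities

-- Finite sums of integers

sumTo-cong≤ : ∀ n {f g : ℕ → ℤ} → (∀ t → t ≤ n → f t ≡ g t) → sumTo n f ≡ sumTo n g
sumTo-cong≤ zero    f≡g = f≡g 0 z≤n
sumTo-cong≤ (suc n) f≡g =
  cong₂ ℤ._+_ (sumTo-cong≤ n λ t t≤n → f≡g t (ℕₚ.m≤n⇒m≤1+n t≤n)) (f≡g (suc n) ℕₚ.≤-refl)

sumTo-cong : ∀ n {f g : ℕ → ℤ} → f ≗ g → sumTo n f ≡ sumTo n g
sumTo-cong n f≡g = sumTo-cong≤ n λ t _ → f≡g t

sumTo-zero : ∀ n {f : ℕ → ℤ} → (∀ t → t ≤ n → f t ≡ + 0) → sumTo n f ≡ + 0
sumTo-zero zero    f≡0 = f≡0 0 z≤n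
sumTo-zero (suc n) f≡0 =
  cong₂ ℤ._+_ (sumTo-zero n λ t t≤n → f≡0 t (ℕₚ.m≤n⇒m≤1+n t≤n)) (f≡0 (suc n) ℕₚ.≤-refl)

sumTo-+ : ∀ n (f g : ℕ → ℤ) → sumTo n (λ t → f t ℤ.+ g t) ≡ sumTo n f ℤ.+ sumTo n g
sumTo-+ zero    f g = refl
sumTo-+ (suc n) f g =
  trans (cong (ℤ._+ (f (suc n) ℤ.+ g (suc n))) (sumTo-+ n f g)) (+-interchange (sumTo n f) (sumTo n g) (f (suc n)) (g (suc n)))

sumTo-*ˡ : ∀ n c (f : ℕ → ℤ) → sumTo n (λ t → c ℤ.* f t) ≡ c ℤ.* sumTo n f
sumTo-*ˡ zero    c f = refl
sumTo-*ˡ (suc n) c f =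
  trans (cong (ℤ._+ (c ℤ.* f (suc n))) (sumTo-*ˡ n c f)) (sym (ℤₚ.*-distribˡ-+ c (sumTo n f) (f (suc n))))

sumTo-*ʳ : ∀ n c (f : ℕ → ℤ) → sumTo n (λ t → f t ℤ.* c) ≡ sumTo n f ℤ.* c
sumTo-*ʳ zero    c f = refl
sumTo-*ʳ (suc n) c f =
  trans (cong (ℤ._+ (f (suc n) ℤ.* c)) (sumTo-*ʳ n c f)) (sym (ℤₚ.*-distribʳ-+ c (sumTo n f) (f (suc n))))

sumTo-suc : ∀ n (f : ℕ → ℤ) → sumTo (suc n) f ≡ f 0 ℤ.+ sumTo n (f ∘ suc)
sumTo-suc zero    f = refl
sumTo-suc (suc n) f =
  trans (cong (ℤ._+ f (suc (suc n))) (sumTo-suc n f)) (ℤₚ.+-assoc (f 0) (sumTo n (f ∘ suc)) (f (suc (suc n))))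

sumTo-reverse : ∀ n (f : ℕ → ℤ) → sumTo n (λ t → f (n ∸ t)) ≡ sumTo n f
sumTo-reverse zero    f = refl
sumTo-reverse (suc n) f =
  trans (sumTo-suc n (λ t → f (suc n ∸ t)))
    (trans (cong (ℤ._+_ (f (suc n))) (sumTo-reverse n f)) (ℤₚ.+-comm (f (suc n)) _))

sumTo-last : ∀ n {f : ℕ → ℤ} → (∀ t → t < n → f t ≡ + 0) → sumTo n f ≡ f n
sumTo-last zero    f≡0 = refl
sumTo-last (suc n) {f} f≡0 =
  trans (cong (ℤ._+ f (suc n)) (sumTo-zero n λ t t≤n → f≡0 t (s≤s t≤n)))
    (ℤₚ.+-identityˡ _)

sumTo-head : ∀ n {f : ℕ → ℤ} → (∀ t → f (suc t) ≡ + 0) → sumTo n f ≡ f 0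
sumTo-head zero    f≡0 = refl
sumTo-head (suc n) {f} f≡0 =
  trans (sumTo-suc n f)
    (trans (cong (ℤ._+_ (f 0)) (sumTo-zero n λ t _ → f≡0 t)) (ℤₚ.+-identityʳ _))

sumTo-truncate : ∀ {m n} {f : ℕ → ℤ} → m ≤ n → (∀ t → m < t → f t ≡ + 0) →
                 sumTo n f ≡ sumTo m f
sumTo-truncate {m} {n} {f} m≤n f≡0 = go n m≤n
  where
  go : ∀ n → m ≤ n → sumTo n f ≡ sumTo m f
  go n m≤n with ℕₚ.m≤n⇒m<n∨m≡n m≤n
  go n       m≤n | inj₂ refl = refl
  go (suc n) m≤n | inj₁ m<n  =
    trans (cong₂ ℤ._+_ (go n (s≤s⁻¹ m<n)) (f≡0 (suc n) m<n)) (ℤₚ.+-identityʳ _)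

sumTo-single : ∀ {m n} {f : ℕ → ℤ} → m ≤ n → (∀ t → t ≢ m → f t ≡ + 0) → sumTo n f ≡ f m
sumTo-single m≤n f≡0 =
  trans (sumTo-truncate m≤n λ t m<t → f≡0 t (ℕₚ.>⇒≢ m<t))
    (sumTo-last _ λ t t<m → f≡0 t (ℕₚ.<⇒≢ t<m))

-- Both sums keep the cutoff n: dropping `f 0` leaves the values of g below n, and the vanishing of
-- `g n` supplies the missing last term.
sumTo-shift : ∀ n {f g : ℕ → ℤ} → f 0 ≡ + 0 → (∀ t → f (suc t) ≡ g t) → g n ≡ + 0 →
              sumTo n f ≡ sumTo n g
sumTo-shift zero    f0≡0 fs≡g gn≡0 = trans f0≡0 (sym gn≡0)
sumTo-shift (suc n) {f} {g} f0≡0 fs≡g gn≡0 = trans (sumTo-suc n f)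
  (trans (cong₂ ℤ._+_ f0≡0 (sumTo-cong n fs≡g))
    (trans (ℤₚ.+-comm (+ 0) (sumTo n g)) (cong (ℤ._+_ (sumTo n g)) (sym gn≡0))))

-- Boolean equality tests and indicators

≡ᵇ-refl : ∀ n → (n ≡ᵇ n) ≡ true
≡ᵇ-refl zero    = refl
≡ᵇ-refl (suc n) = ≡ᵇ-refl n

≢⇒≡ᵇ-false : ∀ {m n} → m ≢ n → (m ≡ᵇ n) ≡ false
≢⇒≡ᵇ-false {zero}  {zero}  m≢n = contradiction refl m≢n
≢⇒≡ᵇ-false {zero}  {suc n} m≢n = refl
≢⇒≡ᵇ-false {suc m} {zero}  m≢n = refl
≢⇒≡ᵇ-false {suc m} {suc n} m≢n = ≢⇒≡ᵇ-false (m≢n ∘ cong suc)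

ind-∧ : ∀ a b → ind (a ∧ b) ≡ ind a ℤ.* ind b
ind-∧ true  b = sym (ℤₚ.*-identityˡ (ind b))
ind-∧ false b = refl

-- Power series in q

Series : Set
Series = ℕ → ℤ

infixl 6 _⊞_
infixl 7 _·_
infix 8 q^_

-- The Cauchy product has the exact form of the innermost sum of `_⊗_`, so a coefficient of a
-- product in `FPS` unfolds to a double sum of products of `Series`.
_⊞_ _·_ : Series → Series → Series
(f ⊞ g) k = f k ℤ.+ g k
(f · g) k = sumTo k λ t → f t ℤ.* g (k ∸ t)

𝟘 : Series
𝟘 k = + 0

q^_ : ℕ → Series
(q^ n) k = ind (k ≡ᵇ n)

·-cong : ∀ {f f′ g g′} → f ≗ f′ → g ≗ g′ → f · g ≗ f′ · g′
·-cong f≗ g≗ k = sumTo-cong k λ t → cong₂ ℤ._*_ (f≗ t) (g≗ (k ∸ t))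

·-suc : ∀ f g k → (f · g) (suc k) ≡ f 0 ℤ.* g (suc k) ℤ.+ ((f ∘ suc) · g) k
·-suc f g k = sumTo-suc k _

·-comm : ∀ f g → f · g ≗ g · f
·-comm f g k = trans (sym (sumTo-reverse k _))
  (sumTo-cong≤ k λ t t≤k →
    trans (ℤₚ.*-comm (f (k ∸ t)) _) (cong (λ s → g s ℤ.* f (k ∸ t)) (ℕₚ.m∸[m∸n]≡n t≤k)))

·-distribʳ : ∀ h f g → (f ⊞ g) · h ≗ (f · h) ⊞ (g · h)
·-distribʳ h f g k = trans
  (sumTo-cong k λ t → ℤₚ.*-distribʳ-+ (h (k ∸ t)) (f t) (g t))
  (sumTo-+ k _ _)

·-scaleˡ : ∀ c f g k → ((λ t → c ℤ.* f t) · g) k ≡ c ℤ.* (f · g) k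
·-scaleˡ c f g k =
  trans (sumTo-cong k λ t → ℤₚ.*-assoc c (f t) _) (sumTo-*ˡ k c _)

-- Induction on the coefficient for all f at once: `·-suc` writes f as its constant term plus q
-- times `f ∘ suc`, and the induction hypothesis is used for `f ∘ suc`.
·-assoc : ∀ f g h → (f · g) · h ≗ f · (g · h)
·-assoc f g h zero    = ℤₚ.*-assoc (f 0) (g 0) (h 0)
·-assoc f g h (suc k) = begin
  ((f · g) · h) (suc k)
    ≡⟨ ·-suc (f · g) h k ⟩
  f 0 ℤ.* g 0 ℤ.* h (suc k) ℤ.+ (((f · g) ∘ suc) · h) k
    ≡⟨ cong₂ ℤ._+_ (ℤₚ.*-assoc (f 0) (g 0) _)
         (trans (·-cong {g = h} (·-suc f g) (λ _ → refl) k) (·-distribʳ h (λ t → f 0 ℤ.* g (suc t)) ((f ∘ suc) · g) k)) ⟩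
  f 0 ℤ.* (g 0 ℤ.* h (suc k)) ℤ.+
    (((λ t → f 0 ℤ.* g (suc t)) · h) k ℤ.+ (((f ∘ suc) · g) · h) k)
    ≡⟨ sym (ℤₚ.+-assoc (f 0 ℤ.* (g 0 ℤ.* h (suc k))) _ _) ⟩
  f 0 ℤ.* (g 0 ℤ.* h (suc k)) ℤ.+ ((λ t → f 0 ℤ.* g (suc t)) · h) k ℤ.+
    (((f ∘ suc) · g) · h) k
    ≡⟨ cong₂ ℤ._+_ (cong (λ z → f 0 ℤ.* (g 0 ℤ.* h (suc k)) ℤ.+ z) (·-scaleˡ (f 0) (g ∘ suc) h k))
         (·-assoc (f ∘ suc) g h k) ⟩
  f 0 ℤ.* (g 0 ℤ.* h (suc k)) ℤ.+ f 0 ℤ.* ((g ∘ suc) · h) k ℤ.+ ((f ∘ suc) · (g · h)) k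
    ≡⟨ cong (ℤ._+ ((f ∘ suc) · (g · h)) k)
         (trans (sym (ℤₚ.*-distribˡ-+ (f 0) (g 0 ℤ.* h (suc k)) _))
           (cong (f 0 ℤ.*_) (sym (·-suc g h k)))) ⟩
  f 0 ℤ.* (g · h) (suc k) ℤ.+ ((f ∘ suc) · (g · h)) k
    ≡⟨ sym (·-suc f (g · h) k) ⟩
  (f · (g · h)) (suc k) ∎
  where open ≡-Reasoning

·-zeroˡ : ∀ f → 𝟘 · f ≗ 𝟘
·-zeroˡ f k = sumTo-zero k λ _ _ → refl

q^suc-· : ∀ c f k → (q^ suc c · f) (suc k) ≡ (q^ c · f) k
q^suc-· c f k = trans (·-suc (q^ suc c) f k) (ℤₚ.+-identityˡ _)

·-identityˡ : ∀ f → q^ 0 · f ≗ f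
·-identityˡ f k = trans (sumTo-head k λ _ → refl) (ℤₚ.*-identityˡ (f k))

·-identityʳ : ∀ f → f · q^ 0 ≗ f
·-identityʳ f k = trans (·-comm f (q^ 0) k) (·-identityˡ f k)

-- This bundle feeds the semiring solver. All recurrences below are arranged with positive terms
-- only, such as f = g + q^c f.
series-commutativeSemiring : CommutativeSemiring 0ℓ 0ℓ
series-commutativeSemiring = record
  { Carrier = Series ; _≈_ = _≗_ ; _+_ = _⊞_ ; _*_ = _·_ ; 0# = 𝟘 ; 1# = q^ 0
  ; isCommutativeSemiring = isCommutativeSemiringˡ (record
    { +-isCommutativeMonoid = record
      { isMonoid = record
        { isSemigroup = record
          { isMagma = record
            { isEquivalence = ≗-isEquivalence
            ; ∙-cong = λ f≗ g≗ k → cong₂ ℤ._+_ (f≗ k) (g≗ k) }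
          ; assoc = λ f g h k → ℤₚ.+-assoc (f k) (g k) (h k) }
        ; identity = (λ f k → ℤₚ.+-identityˡ (f k)) , (λ f k → ℤₚ.+-identityʳ (f k)) }
      ; comm = λ f g k → ℤₚ.+-comm (f k) (g k) }
    ; *-isCommutativeMonoid = record
      { isMonoid = record
        { isSemigroup = record
          { isMagma = record { isEquivalence = ≗-isEquivalence ; ∙-cong = ·-cong }
          ; assoc = ·-assoc }
        ; identity = ·-identityˡ , ·-identityʳ }
      ; comm = ·-comm }
    ; distribʳ = ·-distribʳ
    ; zeroˡ = ·-zeroˡ })
  }
  where ≗-isEquivalence = Setoid.isEquivalence (ℕ →-setoid ℤ)

-- Exponents of the summands

module Exponents where

  module ℕ-Solver = Data.Nat.Solver.+-*-Solver
  open ℕ-Solver using (Polynomial; _:+_; _:*_; _:=_; con)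

  xExp : (a n₁ n₂ n₄ : ℕ) → ℕ
  xExp a n₁ n₂ n₄ = a ℕ.+ (n₁ ℕ.+ n₂ ℕ.+ 2 ℕ.* n₄)

  yExp : (b n₂ n₃ : ℕ) → ℕ
  yExp b n₂ n₃ = b ℕ.+ (n₂ ℕ.+ n₃)

  -- binom stands for n₁ C 2, which the ring solver has to treat as an atom.
  qExp′ : (c t₁ t₂ t₃ t₄ n₁ n₂ n₃ n₄ binom : ℕ) → ℕ
  qExp′ c t₁ t₂ t₃ t₄ n₁ n₂ n₃ n₄ binom =
    c ℕ.+ (t₁ ℕ.* n₁ ℕ.+ t₂ ℕ.* n₂ ℕ.+ t₃ ℕ.* n₃ ℕ.+ t₄ ℕ.* n₄)
      ℕ.+ (2 ℕ.* binom ℕ.+ 2 ℕ.* n₁ ℕ.* n₂ ℕ.+ 4 ℕ.* n₁ ℕ.* n₃ ℕ.+ 4 ℕ.* n₃ ℕ.* n₄)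

  qExp : (c t₁ t₂ t₃ t₄ n₁ n₂ n₃ n₄ : ℕ) → ℕ
  qExp c t₁ t₂ t₃ t₄ n₁ n₂ n₃ n₄ = qExp′ c t₁ t₂ t₃ t₄ n₁ n₂ n₃ n₄ (n₁ C 2)

  qExpᵖ : ∀ {m} → (c t₁ t₂ t₃ t₄ n₁ n₂ n₃ n₄ binom : Polynomial m) → Polynomial m
  qExpᵖ c t₁ t₂ t₃ t₄ n₁ n₂ n₃ n₄ binom =
    c :+ (t₁ :* n₁ :+ t₂ :* n₂ :+ t₃ :* n₃ :+ t₄ :* n₄)
      :+ (con 2 :* binom :+ con 2 :* n₁ :* n₂ :+ con 4 :* n₁ :* n₃ :+ con 4 :* n₃ :* n₄)

  nC2-suc : ∀ n → suc n C 2 ≡ n ℕ.+ n C 2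
  nC2-suc n = trans (sym (nCk+nC[k+1]≡[n+1]C[k+1] n 1)) (cong (ℕ._+ n C 2) (nC1≡n n))

  -- The effect of the factor q^{2n₁} that comes from the recurrence of 1/(q²;q²)_{n₁}.
  qExp-raise₁ : ∀ c t₁ t₂ t₃ t₄ n₁ n₂ n₃ n₄ B →
    2 ℕ.* n₁ ℕ.+ qExp′ c t₁ t₂ t₃ t₄ n₁ n₂ n₃ n₄ B ≡ qExp′ c (2 ℕ.+ t₁) t₂ t₃ t₄ n₁ n₂ n₃ n₄ B
  qExp-raise₁ = ℕ-Solver.solve 10 (λ c t₁ t₂ t₃ t₄ n₁ n₂ n₃ n₄ B →
    con 2 :* n₁ :+ qExpᵖ c t₁ t₂ t₃ t₄ n₁ n₂ n₃ n₄ B :=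
    qExpᵖ c (con 2 :+ t₁) t₂ t₃ t₄ n₁ n₂ n₃ n₄ B) refl

  -- The argument `n₁ ℕ.+ B` is the binomial coefficient at n₁+1, by `nC2-suc`. The quadratic term
  -- raises t₁ by 2, and the cross terms 2n₁n₂ and 4n₁n₃ raise t₂ by 2 and t₃ by 4.
  qExp-shift₁ : ∀ c t₁ t₂ t₃ t₄ n₁ n₂ n₃ n₄ B →
    qExp′ c t₁ t₂ t₃ t₄ (suc n₁) n₂ n₃ n₄ (n₁ ℕ.+ B) ≡
    qExp′ (c ℕ.+ t₁) (2 ℕ.+ t₁) (2 ℕ.+ t₂) (4 ℕ.+ t₃) t₄ n₁ n₂ n₃ n₄ B
  qExp-shift₁ = ℕ-Solver.solve 10 (λ c t₁ t₂ t₃ t₄ n₁ n₂ n₃ n₄ B →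
    qExpᵖ c t₁ t₂ t₃ t₄ (con 1 :+ n₁) n₂ n₃ n₄ (n₁ :+ B) :=
    qExpᵖ (c :+ t₁) (con 2 :+ t₁) (con 2 :+ t₂) (con 4 :+ t₃) t₄ n₁ n₂ n₃ n₄ B) refl

  -- Exhibits t₁(n₁+1) as a lower bound of the exponent; at n₁ = N with t₁ ≥ 1 it exceeds N, which
  -- disposes of the boundary term of the shifted sum.
  qExp-factor₁ : ∀ c t₁ t₂ t₃ t₄ n₁ n₂ n₃ n₄ B →
    qExp′ (c ℕ.+ t₁) (2 ℕ.+ t₁) (2 ℕ.+ t₂) (4 ℕ.+ t₃) t₄ n₁ n₂ n₃ n₄ B ≡
    t₁ ℕ.* suc n₁ ℕ.+ qExp′ c 2 (2 ℕ.+ t₂) (4 ℕ.+ t₃) t₄ n₁ n₂ n₃ n₄ B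
  qExp-factor₁ = ℕ-Solver.solve 10 (λ c t₁ t₂ t₃ t₄ n₁ n₂ n₃ n₄ B →
    qExpᵖ (c :+ t₁) (con 2 :+ t₁) (con 2 :+ t₂) (con 4 :+ t₃) t₄ n₁ n₂ n₃ n₄ B :=
    t₁ :* (con 1 :+ n₁) :+ qExpᵖ c (con 2) (con 2 :+ t₂) (con 4 :+ t₃) t₄ n₁ n₂ n₃ n₄ B) refl

  qExp-raise₂ : ∀ c t₁ t₂ t₃ t₄ n₁ n₂ n₃ n₄ B →
    2 ℕ.* n₂ ℕ.+ qExp′ c t₁ t₂ t₃ t₄ n₁ n₂ n₃ n₄ B ≡ qExp′ c t₁ (2 ℕ.+ t₂) t₃ t₄ n₁ n₂ n₃ n₄ B
  qExp-raise₂ = ℕ-Solver.solve 10 (λ c t₁ t₂ t₃ t₄ n₁ n₂ n₃ n₄ B →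
    con 2 :* n₂ :+ qExpᵖ c t₁ t₂ t₃ t₄ n₁ n₂ n₃ n₄ B :=
    qExpᵖ c t₁ (con 2 :+ t₂) t₃ t₄ n₁ n₂ n₃ n₄ B) refl

  qExp-shift₂ : ∀ c t₁ t₂ t₃ t₄ n₁ n₂ n₃ n₄ B →
    qExp′ c t₁ t₂ t₃ t₄ n₁ (suc n₂) n₃ n₄ B ≡
    qExp′ (c ℕ.+ t₂) (2 ℕ.+ t₁) t₂ t₃ t₄ n₁ n₂ n₃ n₄ B
  qExp-shift₂ = ℕ-Solver.solve 10 (λ c t₁ t₂ t₃ t₄ n₁ n₂ n₃ n₄ B →
    qExpᵖ c t₁ t₂ t₃ t₄ n₁ (con 1 :+ n₂) n₃ n₄ B :=
    qExpᵖ (c :+ t₂) (con 2 :+ t₁) t₂ t₃ t₄ n₁ n₂ n₃ n₄ B) refl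

  qExp-factor₂ : ∀ c t₁ t₂ t₃ t₄ n₁ n₂ n₃ n₄ B →
    qExp′ (c ℕ.+ t₂) (2 ℕ.+ t₁) t₂ t₃ t₄ n₁ n₂ n₃ n₄ B ≡
    t₂ ℕ.* suc n₂ ℕ.+ qExp′ c (2 ℕ.+ t₁) 0 t₃ t₄ n₁ n₂ n₃ n₄ B
  qExp-factor₂ = ℕ-Solver.solve 10 (λ c t₁ t₂ t₃ t₄ n₁ n₂ n₃ n₄ B →
    qExpᵖ (c :+ t₂) (con 2 :+ t₁) t₂ t₃ t₄ n₁ n₂ n₃ n₄ B :=
    t₂ :* (con 1 :+ n₂) :+ qExpᵖ c (con 2 :+ t₁) (con 0) t₃ t₄ n₁ n₂ n₃ n₄ B) refl

  xExp-suc₂ : ∀ a n₁ n₂ n₄ → xExp a n₁ (suc n₂) n₄ ≡ xExp (1 ℕ.+ a) n₁ n₂ n₄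
  xExp-suc₂ = ℕ-Solver.solve 4 (λ a n₁ n₂ n₄ →
    a :+ (n₁ :+ (con 1 :+ n₂) :+ con 2 :* n₄) := con 1 :+ a :+ (n₁ :+ n₂ :+ con 2 :* n₄)) refl

  qExp-raise₃ : ∀ c t₁ t₂ t₃ t₄ n₁ n₂ n₃ n₄ B →
    4 ℕ.* n₃ ℕ.+ qExp′ c t₁ t₂ t₃ t₄ n₁ n₂ n₃ n₄ B ≡ qExp′ c t₁ t₂ (4 ℕ.+ t₃) t₄ n₁ n₂ n₃ n₄ B
  qExp-raise₃ = ℕ-Solver.solve 10 (λ c t₁ t₂ t₃ t₄ n₁ n₂ n₃ n₄ B →
    con 4 :* n₃ :+ qExpᵖ c t₁ t₂ t₃ t₄ n₁ n₂ n₃ n₄ B :=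
    qExpᵖ c t₁ t₂ (con 4 :+ t₃) t₄ n₁ n₂ n₃ n₄ B) refl

  qExp-shift₃ : ∀ c t₁ t₂ t₃ t₄ n₁ n₂ n₃ n₄ B →
    qExp′ c t₁ t₂ t₃ t₄ n₁ n₂ (suc n₃) n₄ B ≡
    qExp′ (c ℕ.+ t₃) (4 ℕ.+ t₁) t₂ t₃ (4 ℕ.+ t₄) n₁ n₂ n₃ n₄ B
  qExp-shift₃ = ℕ-Solver.solve 10 (λ c t₁ t₂ t₃ t₄ n₁ n₂ n₃ n₄ B →
    qExpᵖ c t₁ t₂ t₃ t₄ n₁ n₂ (con 1 :+ n₃) n₄ B :=
    qExpᵖ (c :+ t₃) (con 4 :+ t₁) t₂ t₃ (con 4 :+ t₄) n₁ n₂ n₃ n₄ B) refl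

  qExp-factor₃ : ∀ c t₁ t₂ t₃ t₄ n₁ n₂ n₃ n₄ B →
    qExp′ (c ℕ.+ t₃) (4 ℕ.+ t₁) t₂ t₃ (4 ℕ.+ t₄) n₁ n₂ n₃ n₄ B ≡
    t₃ ℕ.* suc n₃ ℕ.+ qExp′ c (4 ℕ.+ t₁) t₂ 0 (4 ℕ.+ t₄) n₁ n₂ n₃ n₄ B
  qExp-factor₃ = ℕ-Solver.solve 10 (λ c t₁ t₂ t₃ t₄ n₁ n₂ n₃ n₄ B →
    qExpᵖ (c :+ t₃) (con 4 :+ t₁) t₂ t₃ (con 4 :+ t₄) n₁ n₂ n₃ n₄ B :=
    t₃ :* (con 1 :+ n₃) :+ qExpᵖ c (con 4 :+ t₁) t₂ (con 0) (con 4 :+ t₄) n₁ n₂ n₃ n₄ B) refl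

  yExp-suc₃ : ∀ b n₂ n₃ → yExp b n₂ (suc n₃) ≡ yExp (1 ℕ.+ b) n₂ n₃
  yExp-suc₃ = ℕ-Solver.solve 3 (λ b n₂ n₃ → b :+ (n₂ :+ (con 1 :+ n₃)) := con 1 :+ b :+ (n₂ :+ n₃)) refl

  qExp-raise₄ : ∀ c t₁ t₂ t₃ t₄ n₁ n₂ n₃ n₄ B →
    4 ℕ.* n₄ ℕ.+ qExp′ c t₁ t₂ t₃ t₄ n₁ n₂ n₃ n₄ B ≡ qExp′ c t₁ t₂ t₃ (4 ℕ.+ t₄) n₁ n₂ n₃ n₄ B
  qExp-raise₄ = ℕ-Solver.solve 10 (λ c t₁ t₂ t₃ t₄ n₁ n₂ n₃ n₄ B →
    con 4 :* n₄ :+ qExpᵖ c t₁ t₂ t₃ t₄ n₁ n₂ n₃ n₄ B :=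
    qExpᵖ c t₁ t₂ t₃ (con 4 :+ t₄) n₁ n₂ n₃ n₄ B) refl

  qExp-shift₄ : ∀ c t₁ t₂ t₃ t₄ n₁ n₂ n₃ n₄ B →
    qExp′ c t₁ t₂ t₃ t₄ n₁ n₂ n₃ (suc n₄) B ≡
    qExp′ (c ℕ.+ t₄) t₁ t₂ (4 ℕ.+ t₃) t₄ n₁ n₂ n₃ n₄ B
  qExp-shift₄ = ℕ-Solver.solve 10 (λ c t₁ t₂ t₃ t₄ n₁ n₂ n₃ n₄ B →
    qExpᵖ c t₁ t₂ t₃ t₄ n₁ n₂ n₃ (con 1 :+ n₄) B :=
    qExpᵖ (c :+ t₄) t₁ t₂ (con 4 :+ t₃) t₄ n₁ n₂ n₃ n₄ B) refl

  qExp-factor₄ : ∀ c t₁ t₂ t₃ t₄ n₁ n₂ n₃ n₄ B →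
    qExp′ (c ℕ.+ t₄) t₁ t₂ (4 ℕ.+ t₃) t₄ n₁ n₂ n₃ n₄ B ≡
    t₄ ℕ.* suc n₄ ℕ.+ qExp′ c t₁ t₂ (4 ℕ.+ t₃) 0 n₁ n₂ n₃ n₄ B
  qExp-factor₄ = ℕ-Solver.solve 10 (λ c t₁ t₂ t₃ t₄ n₁ n₂ n₃ n₄ B →
    qExpᵖ (c :+ t₄) t₁ t₂ (con 4 :+ t₃) t₄ n₁ n₂ n₃ n₄ B :=
    t₄ :* (con 1 :+ n₄) :+ qExpᵖ c t₁ t₂ (con 4 :+ t₃) (con 0) n₁ n₂ n₃ n₄ B) refl

  xExp-suc₄ : ∀ a n₁ n₂ n₄ → xExp a n₁ n₂ (suc n₄) ≡ xExp (2 ℕ.+ a) n₁ n₂ n₄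
  xExp-suc₄ = ℕ-Solver.solve 4 (λ a n₁ n₂ n₄ →
    a :+ (n₁ :+ n₂ :+ con 2 :* (con 1 :+ n₄)) := con 2 :+ a :+ (n₁ :+ n₂ :+ con 2 :* n₄)) refl

  -- Substituting xq² for x multiplies a term by q to twice its x-exponent, here absorbed into c,
  -- t₁, t₂ and t₄.
  qExp-dilate : ∀ a c t₁ t₂ t₃ t₄ n₁ n₂ n₃ n₄ B →
    2 ℕ.* xExp a n₁ n₂ n₄ ℕ.+ qExp′ c t₁ t₂ t₃ t₄ n₁ n₂ n₃ n₄ B ≡
    qExp′ (2 ℕ.* a ℕ.+ c) (2 ℕ.+ t₁) (2 ℕ.+ t₂) t₃ (4 ℕ.+ t₄) n₁ n₂ n₃ n₄ B
  qExp-dilate = ℕ-Solver.solve 11 (λ a c t₁ t₂ t₃ t₄ n₁ n₂ n₃ n₄ B →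
    con 2 :* (a :+ (n₁ :+ n₂ :+ con 2 :* n₄)) :+ qExpᵖ c t₁ t₂ t₃ t₄ n₁ n₂ n₃ n₄ B :=
    qExpᵖ (con 2 :* a :+ c) (con 2 :+ t₁) (con 2 :+ t₂) t₃ (con 4 :+ t₄) n₁ n₂ n₃ n₄ B) refl

  term-exponent₁ : ∀ n₁ n₂ n₃ n₄ B →
    n₁ ℕ.+ 3 ℕ.* n₂ ℕ.+ 2 ℕ.* n₃ ℕ.+ 2 ℕ.* n₄
      ℕ.+ (2 ℕ.* B ℕ.+ 2 ℕ.* n₁ ℕ.* n₂ ℕ.+ 4 ℕ.* n₁ ℕ.* n₃ ℕ.+ 4 ℕ.* n₃ ℕ.* n₄) ≡
    qExp′ 0 1 3 2 2 n₁ n₂ n₃ n₄ B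
  term-exponent₁ = ℕ-Solver.solve 5 (λ n₁ n₂ n₃ n₄ B →
    n₁ :+ con 3 :* n₂ :+ con 2 :* n₃ :+ con 2 :* n₄
      :+ (con 2 :* B :+ con 2 :* n₁ :* n₂ :+ con 4 :* n₁ :* n₃ :+ con 4 :* n₃ :* n₄) :=
    qExpᵖ (con 0) (con 1) (con 3) (con 2) (con 2) n₁ n₂ n₃ n₄ B) refl

  -- The q-power of x²yq^{4+4(n₁+n₃)} is absorbed by raising c, t₁ and t₃ by 4 each.
  term-exponent₂ : ∀ n₁ n₂ n₃ n₄ B →
    qExp′ 0 1 3 2 2 n₁ n₂ n₃ n₄ B ℕ.+ (4 ℕ.+ 4 ℕ.* (n₁ ℕ.+ n₃)) ≡
    qExp′ 4 5 3 6 2 n₁ n₂ n₃ n₄ B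
  term-exponent₂ = ℕ-Solver.solve 5 (λ n₁ n₂ n₃ n₄ B →
    qExpᵖ (con 0) (con 1) (con 3) (con 2) (con 2) n₁ n₂ n₃ n₄ B
      :+ (con 4 :+ con 4 :* (n₁ :+ n₃)) :=
    qExpᵖ (con 4) (con 5) (con 3) (con 6) (con 2) n₁ n₂ n₃ n₄ B) refl

  base-exponent : ∀ n → qExp′ 0 1 3 2 2 0 0 n 0 0 ≡ 2 ℕ.* n
  base-exponent = ℕ-Solver.solve 1 (λ n →
    qExpᵖ (con 0) (con 1) (con 3) (con 2) (con 2) (con 0) (con 0) n (con 0) (con 0) := con 2 :* n) refl

open Exponents

-- Congruence modulo powers of q, and multiplication by q^c

infix 4 _≈[_]_

-- Congruence modulo q^{N+1}, the sense in which recurrences of sums and products truncated at N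
-- hold.
_≈[_]_ : Series → ℕ → Series → Set
f ≈[ N ] g = ∀ k → k ≤ N → f k ≡ g k

·-cong≤ : ∀ {N f f′ g g′} → f ≈[ N ] f′ → g ≈[ N ] g′ → f · g ≈[ N ] f′ · g′
·-cong≤ f≈ g≈ k k≤N = sumTo-cong≤ k λ t t≤k →
  cong₂ ℤ._*_ (f≈ t (ℕₚ.≤-trans t≤k k≤N)) (g≈ (k ∸ t) (ℕₚ.≤-trans (ℕₚ.m∸n≤m k t) k≤N))

q^-· : ∀ a b → q^ a · q^ b ≗ q^ (a ℕ.+ b)
q^-· zero    b k       = ·-identityˡ (q^ b) k
q^-· (suc a) b zero    = refl
q^-· (suc a) b (suc k) = trans (q^suc-· a (q^ b) k) (q^-· a b k)

q^-·-low : ∀ c f {k} → k < c → (q^ c · f) k ≡ + 0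
q^-·-low (suc c) f {zero}  k<c = refl
q^-·-low (suc c) f {suc k} k<c = trans (q^suc-· c f k) (q^-·-low c f (s≤s⁻¹ k<c))

q^-·-+ : ∀ c f r → (q^ c · f) (c ℕ.+ r) ≡ f r
q^-·-+ zero    f r = ·-identityˡ f r
q^-·-+ (suc c) f r = trans (q^suc-· c f (c ℕ.+ r)) (q^-·-+ c f r)

-- As c ≥ 1, the equation f = g + q^c f expresses each coefficient of f by the same coefficient of g
-- and strictly lower ones of f.
q^-fixpoint-unique : ∀ {N} c .{{_ : NonZero c}} {f f′ g g′} → g ≈[ N ] g′ →
  f ≈[ N ] (g ⊞ q^ c · f) → f′ ≈[ N ] (g′ ⊞ q^ c · f′) → f ≈[ N ] f′
q^-fixpoint-unique {N} (suc c) {f} {f′} {g} {g′} g≈ f≈ f′≈ k = below k k ℕₚ.≤-refl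
  where
  -- The bound m makes the strong induction structural: the step needs all coefficients t ≤ k, not
  -- only the preceding one.
  below : ∀ m k → k ≤ m → k ≤ N → f k ≡ f′ k
  below m zero _ 0≤N =
    trans (f≈ 0 0≤N) (trans (cong (ℤ._+ + 0) (g≈ 0 0≤N)) (sym (f′≈ 0 0≤N)))
  below (suc m) (suc k) (s≤s k≤m) 1+k≤N =
    trans (f≈ (suc k) 1+k≤N) (trans (cong₂ ℤ._+_ (g≈ (suc k) 1+k≤N) shifted)
      (sym (f′≈ (suc k) 1+k≤N)))
    where
    shifted : (q^ suc c · f) (suc k) ≡ (q^ suc c · f′) (suc k)
    shifted = trans (q^suc-· c f k) (trans
      (·-cong≤ {f = q^ c} {g = f} {g′ = f′} (λ _ _ → refl)
        (λ t t≤k → below m t (ℕₚ.≤-trans t≤k k≤m) (ℕₚ.≤-trans t≤k (ℕₚ.<⇒≤ 1+k≤N)))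
        k ℕₚ.≤-refl)
      (sym (q^suc-· c f′ k)))

open CommutativeSemiring series-commutativeSemiring using ()
  renaming (refl to ≗-refl; sym to ≗-sym; trans to ≗-trans; +-cong to ⊞-cong)
open import Algebra.Solver.Ring.NaturalCoefficients.Default series-commutativeSemiring
  using (solve; _:+_; _:*_; _:=_; con)

·-congˡ : ∀ h {f g} → f ≗ g → h · f ≗ h · g
·-congˡ h = ·-cong {f = h} ≗-refl

·-congʳ : ∀ h {f g} → f ≗ g → f · h ≗ g · h
·-congʳ h f≗g = ·-cong f≗g (≗-refl {x = h})

⊞-congˡ : ∀ h {f g} → f ≗ g → h ⊞ f ≗ h ⊞ g
⊞-congˡ h = ⊞-cong (≗-refl {x = h})

⊞-congʳ : ∀ h {f g} → f ≗ g → f ⊞ h ≗ g ⊞ h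
⊞-congʳ h f≗g = ⊞-cong f≗g (≗-refl {x = h})

·-zeroʳ : ∀ f → f · 𝟘 ≗ 𝟘
·-zeroʳ f = ≗-trans (·-comm f 𝟘) (·-zeroˡ f)

q^-cong : ∀ {m n} → m ≡ n → q^ m ≗ q^ n
q^-cong m≡n k = cong (λ n → (q^ n) k) m≡n

-- Geometric series and the reciprocals 1/(q^d;q^d)_n

geom₀ : ℕ → Series
geom₀ c k = sumTo k λ m → ind (k ≡ᵇ c ℕ.* m)

+-≡ᵇ-cancelˡ : ∀ c m n → (c ℕ.+ m ≡ᵇ c ℕ.+ n) ≡ (m ≡ᵇ n)
+-≡ᵇ-cancelˡ zero    m n = refl
+-≡ᵇ-cancelˡ (suc c) m n = +-≡ᵇ-cancelˡ c m n

q^-low : ∀ {k n} → k < n → (q^ n) k ≡ + 0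
q^-low k<n = cong ind (≢⇒≡ᵇ-false (ℕₚ.<⇒≢ k<n))

m<n⇒m<[1+c]*n : ∀ c {m n} → m < n → m < suc c ℕ.* n
m<n⇒m<[1+c]*n c m<n = ℕₚ.≤-trans m<n (ℕₚ.m≤m+n _ _)

-- The relation 1/(1-z) = 1 + z/(1-z) at z = q^{c+1}. Below q^{c+1} only m = 0 contributes; from
-- there on the summation index is shifted by one.
geom₀-unfold : ∀ c → geom₀ (suc c) ≗ q^ 0 ⊞ q^ suc c · geom₀ (suc c)
geom₀-unfold c k with ℕₚ.<-≤-connex k (suc c)
... | inj₁ k<1+c = trans
  (sumTo-head k λ t → q^-low (ℕₚ.≤-trans k<1+c (ℕₚ.m≤m*n (suc c) (suc t))))
  (trans (cong (λ n → (q^ n) k) (ℕₚ.*-zeroʳ (suc c)))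
    (sym (trans (cong (ℤ._+_ ((q^ 0) k)) (q^-·-low (suc c) (geom₀ (suc c)) k<1+c))
           (ℤₚ.+-identityʳ ((q^ 0) k)))))
... | inj₂ 1+c≤k with ℕₚ.m≤n⇒∃[o]m+o≡n 1+c≤k
... | r , refl = begin
  geom₀ (suc c) (suc (c ℕ.+ r))
    ≡⟨ sumTo-suc (c ℕ.+ r) _ ⟩
  (q^ (c ℕ.* 0)) (suc (c ℕ.+ r)) ℤ.+ sumTo (c ℕ.+ r) (λ m → (q^ (suc c ℕ.* suc m)) (suc (c ℕ.+ r)))
    ≡⟨ cong₂ ℤ._+_ (cong (λ n → (q^ n) (suc (c ℕ.+ r))) (ℕₚ.*-zeroʳ c))
         (sumTo-cong (c ℕ.+ r) λ m → cong ind (trans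
           (cong (suc (c ℕ.+ r) ≡ᵇ_) (ℕₚ.*-suc (suc c) m))
           (+-≡ᵇ-cancelˡ (suc c) r (suc c ℕ.* m)))) ⟩
  + 0 ℤ.+ sumTo (c ℕ.+ r) (λ m → (q^ (suc c ℕ.* m)) r)
    -- The shifted sum still runs to c+r, but a term with m > r has exponent above r.
    ≡⟨ cong (ℤ._+_ (+ 0)) (sumTo-truncate (ℕₚ.m≤n+m r c) λ m r<m → q^-low (m<n⇒m<[1+c]*n c r<m)) ⟩
  + 0 ℤ.+ geom₀ (suc c) r
    ≡⟨ cong (ℤ._+_ (+ 0)) (sym (q^-·-+ (suc c) (geom₀ (suc c)) r)) ⟩
  + 0 ℤ.+ (q^ suc c · geom₀ (suc c)) (suc c ℕ.+ r) ∎
  where open ≡-Reasoning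

-- 1/(q^d;q^d)_n
invPoch₀ : ℕ → ℕ → Series
invPoch₀ d n = invPoch 0 0 d d n 0 0

-- At x⁰y⁰ the product `_⊗_` with the last `geom` factor computes to `_·_` with `geom₀`, which is
-- then unfolded once.
invPoch₀-suc : ∀ d .{{_ : NonZero d}} n →
  invPoch₀ d (suc n) ≗ invPoch₀ d n ⊞ q^ (d ℕ.* suc n) · invPoch₀ d (suc n)
invPoch₀-suc d@(suc d-1) n rewrite ℕₚ.*-suc d n = ≗-trans
  (·-cong {f = invPoch₀ d n} ≗-refl (geom₀-unfold (d-1 ℕ.+ d ℕ.* n)))
  (solve 3 (λ p c g → p :* (con 1 :+ c :* g) := p :+ c :* (p :* g)) ≗-refl
    (invPoch₀ d n) (q^ (d ℕ.+ d ℕ.* n)) (geom₀ (d ℕ.+ d ℕ.* n)))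

-- The value 0 at n = 0 is forced by 1/(q^d;q^d)_{n-1} = (1-q^{dn})/(q^d;q^d)_n. With it the
-- recurrence applies to every summand of a sum over n ≥ 0.
invPoch₀-pred : ℕ → ℕ → Series
invPoch₀-pred d zero    = 𝟘
invPoch₀-pred d (suc n) = invPoch₀ d n

invPoch₀-rec : ∀ d .{{_ : NonZero d}} n →
  invPoch₀ d n ≗ invPoch₀-pred d n ⊞ q^ (d ℕ.* n) · invPoch₀ d n
invPoch₀-rec d zero rewrite ℕₚ.*-zeroʳ d = λ k →
  sym (trans (ℤₚ.+-identityˡ _) (·-identityˡ (q^ 0) k))
invPoch₀-rec d (suc n) = invPoch₀-suc d n

module ≗-Reasoning = SetoidReasoning (CommutativeSemiring.setoid series-commutativeSemiring)

q^-*-suc : ∀ e i → q^ (e ℕ.* suc i) ≗ q^ e · q^ (e ℕ.* i)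
q^-*-suc e i = ≗-trans (q^-cong (ℕₚ.*-suc e i)) (≗-sym (q^-· e (e ℕ.* i)))

-- For A_i = q^{ei}/(q^d;q^d)_i this reads A_{i+1} = q^e A_i + q^{d(i+1)} A_{i+1}, a fixed-point
-- equation for A_{i+1}. Both sides of the identity are compared with it.
q^-invPoch₀-rec : ∀ e d .{{_ : NonZero d}} i →
  q^ (e ℕ.* suc i) · invPoch₀ d (suc i) ≗
  q^ e · (q^ (e ℕ.* i) · invPoch₀ d i) ⊞
  q^ (d ℕ.* suc i) · (q^ (e ℕ.* suc i) · invPoch₀ d (suc i))
q^-invPoch₀-rec e d i = begin
  q^ (e ℕ.* suc i) · p′
    ≈⟨ ·-cong (q^-*-suc e i) (invPoch₀-suc d i) ⟩
  (x · y) · (p ⊞ z · p′)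
    ≈⟨ solve 5 (λ x y z p p′ → (x :* y) :* (p :+ z :* p′) := x :* (y :* p) :+ z :* ((x :* y) :* p′))
         ≗-refl x y z p p′ ⟩
  x · (y · p) ⊞ z · ((x · y) · p′)
    ≈⟨ ⊞-congˡ (x · (y · p)) (·-congˡ z (·-congʳ p′ (≗-sym (q^-*-suc e i)))) ⟩
  x · (y · p) ⊞ z · (q^ (e ℕ.* suc i) · p′) ∎
  where
  open ≗-Reasoning
  x = q^ e
  y = q^ (e ℕ.* i)
  z = q^ (d ℕ.* suc i)
  p = invPoch₀ d i
  p′ = invPoch₀ d (suc i)

-- E n i plays the role of the z^i-coefficient of 1/(zq^e;q^d)_n, whose last factor gives
-- E-suc; splitting off the first factor instead yields the recurrence of the limit.
module Euler (e d : ℕ) .{{e≢0 : NonZero e}} .{{d≢0 : NonZero d}}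
  (E : ℕ → ℕ → Series)
  (E-zero : ∀ n → E n 0 ≗ q^ 0)
  (E-one  : ∀ i → E 0 (suc i) ≗ 𝟘)
  (E-suc  : ∀ n i → E (suc n) (suc i) ≗ E n (suc i) ⊞ q^ (e ℕ.+ d ℕ.* n) · E (suc n) i)
  where

  open ≗-Reasoning

  private
    q^-factor-suc : ∀ n → q^ (e ℕ.+ d ℕ.* suc n) ≗ q^ d · q^ (e ℕ.+ d ℕ.* n)
    q^-factor-suc n = ≗-trans (q^-cong (eq e d n)) (≗-sym (q^-· d (e ℕ.+ d ℕ.* n)))
      where
      eq : ∀ e d n → e ℕ.+ d ℕ.* suc n ≡ d ℕ.+ (e ℕ.+ d ℕ.* n)
      eq = solve-∀

  -- With F_n(z) = 1/(zq^e;q^d)_n this is the coefficient form of (1-zq^e) F_{n+1}(z) = F_n(zq^d).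
  -- It is proved from `E-suc` by a mutual induction with `first-last-factors`.
  E-first-factor : ∀ n i →
    E (suc n) (suc i) ≗ q^ (d ℕ.* suc i) · E n (suc i) ⊞ q^ e · E (suc n) i

  private
    -- What remains of the induction step for `E-first-factor` once the term common to both
    -- expansions is set aside.
    first-last-factors : ∀ n i →
      q^ e · E (suc n) i ⊞ q^ (e ℕ.+ d ℕ.* suc n) · E (suc (suc n)) i ≗
      (q^ (d ℕ.* suc i) · q^ (e ℕ.+ d ℕ.* n)) · E (suc n) i ⊞ q^ e · E (suc (suc n)) i
    -- All constant terms are 1, so the two summands merely change places.
    first-last-factors n zero = begin
      q^ e · E (suc n) 0 ⊞ q^ (e ℕ.+ d ℕ.* suc n) · E (suc (suc n)) 0
        ≈⟨ ⊞-cong (·-congˡ (q^ e) E≗E)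
             (·-cong (≗-trans (q^-factor-suc n)
               (·-congʳ (q^ (e ℕ.+ d ℕ.* n)) (q^-cong (sym (ℕₚ.*-identityʳ d))))) (≗-sym E≗E)) ⟩
      q^ e · E (suc (suc n)) 0 ⊞ (q^ (d ℕ.* 1) · q^ (e ℕ.+ d ℕ.* n)) · E (suc n) 0
        ≈⟨ (λ k → ℤₚ.+-comm ((q^ e · E (suc (suc n)) 0) k) _) ⟩
      (q^ (d ℕ.* 1) · q^ (e ℕ.+ d ℕ.* n)) · E (suc n) 0 ⊞ q^ e · E (suc (suc n)) 0 ∎
      where
      E≗E : E (suc n) 0 ≗ E (suc (suc n)) 0
      E≗E = ≗-trans (E-zero (suc n)) (≗-sym (E-zero (suc (suc n))))
    first-last-factors n (suc i) = begin
      f · a ⊞ q^ (e ℕ.+ d ℕ.* suc n) · E (suc (suc n)) (suc i)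
        ≈⟨ ⊞-congˡ (f · a) (·-cong (q^-factor-suc n) (E-first-factor (suc n) i)) ⟩
      f · a ⊞ (D · c) · (g · a ⊞ f · b)
        ≈⟨ solve 6 (λ D c g f a b →
             f :* a :+ (D :* c) :* (g :* a :+ f :* b) :=
             ((D :* g) :* c) :* a :+ f :* (a :+ (D :* c) :* b)) ≗-refl D c g f a b ⟩
      ((D · g) · c) · a ⊞ f · (a ⊞ (D · c) · b)
        ≈⟨ ⊞-cong (·-congʳ a (·-congʳ c (≗-sym (q^-*-suc d (suc i)))))
             (·-congˡ f (≗-trans (⊞-congˡ a (·-congʳ b (≗-sym (q^-factor-suc n))))
               (≗-sym (E-suc (suc n) i)))) ⟩
      (q^ (d ℕ.* suc (suc i)) · c) · a ⊞ f · E (suc (suc n)) (suc i) ∎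
      where
      D = q^ d
      c = q^ (e ℕ.+ d ℕ.* n)
      g = q^ (d ℕ.* suc i)
      f = q^ e
      a = E (suc n) (suc i)
      b = E (suc (suc n)) i

  E-first-factor zero i = begin
    E 1 (suc i)
      ≈⟨ E-suc 0 i ⟩
    E 0 (suc i) ⊞ q^ (e ℕ.+ d ℕ.* 0) · E 1 i
      ≈⟨ ⊞-cong (E-one i) (·-congʳ (E 1 i)
           (q^-cong (trans (cong (e ℕ.+_) (ℕₚ.*-zeroʳ d)) (ℕₚ.+-identityʳ e)))) ⟩
    𝟘 ⊞ q^ e · E 1 i
      ≈⟨ ⊞-congʳ (q^ e · E 1 i) (≗-trans (≗-sym (·-zeroʳ g)) (·-congˡ g (≗-sym (E-one i)))) ⟩
    g · E 0 (suc i) ⊞ q^ e · E 1 i ∎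
    where
    g = q^ (d ℕ.* suc i)
  E-first-factor (suc n) i = begin
    E (suc (suc n)) (suc i)
      ≈⟨ E-suc (suc n) i ⟩
    E (suc n) (suc i) ⊞ z
      ≈⟨ ⊞-congʳ z (E-first-factor n i) ⟩
    (g · a ⊞ f · b) ⊞ z
      ≈⟨ (λ k → ℤₚ.+-assoc ((g · a) k) ((f · b) k) (z k)) ⟩
    g · a ⊞ (f · b ⊞ z)
      ≈⟨ ⊞-congˡ (g · a) (first-last-factors n i) ⟩
    g · a ⊞ ((g · c) · b ⊞ y)
      ≈⟨ solve 5 (λ g a c b y → g :* a :+ ((g :* c) :* b :+ y) := g :* (a :+ c :* b) :+ y)
           ≗-refl g a c b y ⟩
    g · (a ⊞ c · b) ⊞ y
      ≈⟨ ⊞-congʳ y (·-congˡ g (≗-sym (E-suc n i))) ⟩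
    g · E (suc n) (suc i) ⊞ y ∎
    where
    g = q^ (d ℕ.* suc i)
    f = q^ e
    a = E n (suc i)
    b = E (suc n) i
    c = q^ (e ℕ.+ d ℕ.* n)
    y = q^ e · E (suc (suc n)) i
    z = q^ (e ℕ.+ d ℕ.* suc n) · E (suc (suc n)) i

  -- The additional factor is 1/(1-zq^{e+dN}), and e+dN > N because e and d are positive.
  E-stable : ∀ N i → E N (suc i) ≈[ N ] E (suc N) (suc i)
  E-stable N i k k≤N = sym (trans (E-suc N i k) (trans
    (cong (ℤ._+_ (E N (suc i) k)) (q^-·-low (e ℕ.+ d ℕ.* N) (E (suc N) i)
      (ℕₚ.≤-<-trans k≤N (ℕₚ.≤-<-trans (ℕₚ.m≤n*m N d) (ℕₚ.m<n+m (d ℕ.* N) (ℕ.>-nonZero⁻¹ e))))))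
    (ℤₚ.+-identityʳ (E N (suc i) k))))

  -- By induction on i, both sides solve the same equation f = g + q^{d(i+1)} f modulo q^{N+1}.
  E-limit : ∀ N i → E (suc N) i ≈[ N ] q^ (e ℕ.* i) · invPoch₀ d i
  E-limit N zero k k≤N rewrite ℕₚ.*-zeroʳ e =
    trans (E-zero (suc N) k) (sym (·-identityˡ (q^ 0) k))
  E-limit N (suc i) = q^-fixpoint-unique (d ℕ.* suc i) {{ℕₚ.m*n≢0 d (suc i)}}
    (·-cong≤ {f = q^ e} {g = E (suc N) i} (λ _ _ → refl) (E-limit N i))
    -- `E-first-factor` has `E N` on its right; stability replaces it by `E (suc N)`, which closes
    -- the fixed-point equation.
    (λ k k≤N → trans (E-first-factor N i k) (trans
      (ℤₚ.+-comm ((q^ (d ℕ.* suc i) · E N (suc i)) k) ((q^ e · E (suc N) i) k))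
      (cong (ℤ._+_ ((q^ e · E (suc N) i) k))
        (·-cong≤ {f = q^ (d ℕ.* suc i)} {g = E N (suc i)} (λ _ _ → refl) (E-stable N i) k k≤N))))
    (λ k _ → q^-invPoch₀-rec e d i k)

-- Series in x and y with coefficients in q

·-sumTo : ∀ n f (g : ℕ → Series) →
  f · (λ k → sumTo n λ t → g t k) ≗ λ k → sumTo n λ t → (f · g t) k
·-sumTo zero    f g k = refl
·-sumTo (suc n) f g k = trans
  (CommutativeSemiring.distribˡ series-commutativeSemiring f
    (λ k → sumTo n λ t → g t k) (g (suc n)) k)
  (cong (ℤ._+ (f · g (suc n)) k) (·-sumTo n f g k))

NoX NoY : FPS → Set
NoX F = ∀ i j → F (suc i) j ≗ 𝟘
NoY F = ∀ i j → F i (suc j) ≗ 𝟘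

·-zero-left : ∀ {f} g → f ≗ 𝟘 → f · g ≗ 𝟘
·-zero-left g f≗𝟘 = ≗-trans (·-congʳ g f≗𝟘) (·-zeroˡ g)

·-zero-right : ∀ f {g} → g ≗ 𝟘 → f · g ≗ 𝟘
·-zero-right f g≗𝟘 = ≗-trans (·-congˡ f g≗𝟘) (·-zeroʳ f)

⊗-NoX : ∀ {F G} → NoX F → NoX G → NoX (F ⊗ G)
⊗-NoX {F} {G} F-NoX G-NoX i j k = sumTo-zero (suc i) λ
  { zero    _ → sumTo-zero j λ b _ → ·-zero-right (F 0 b) (G-NoX i (j ∸ b)) k
  ; (suc a) _ → sumTo-zero j λ b _ → ·-zero-left (G (i ∸ a) (j ∸ b)) (F-NoX a b) k }

⊗-NoY : ∀ {F G} → NoY F → NoY G → NoY (F ⊗ G)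
⊗-NoY {F} {G} F-NoY G-NoY i j k = sumTo-zero i λ a _ → sumTo-zero (suc j) λ
  { zero    _ → ·-zero-right (F a 0) (G-NoY (i ∸ a) j) k
  ; (suc b) _ → ·-zero-left (G (i ∸ a) (j ∸ b)) (F-NoY a b) k }

NoX-∸ : ∀ {G} → NoX G → ∀ {i a} j → a < i → G (i ∸ a) j ≗ 𝟘
NoX-∸ G-NoX {i} {a} j a<i with i ∸ a in i∸a≡
... | zero  = contradiction (ℕₚ.m∸n≡0⇒m≤n i∸a≡) (ℕₚ.<⇒≱ a<i)
... | suc m = G-NoX m j

NoY-∸ : ∀ {G} → NoY G → ∀ {j b} i → b < j → G i (j ∸ b) ≗ 𝟘
NoY-∸ {G} G-NoY = NoX-∸ {λ j i → G i j} (λ j i → G-NoY i j)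

⊗-NoX-right : ∀ F {G} → NoX G → ∀ i j k →
  (F ⊗ G) i j k ≡ sumTo j λ b → (F i b · G 0 (j ∸ b)) k
⊗-NoX-right F {G} G-NoX i j k = trans
  (sumTo-last i λ a a<i → sumTo-zero j λ b _ →
    ·-zero-right (F a b) (NoX-∸ {G} G-NoX (j ∸ b) a<i) k)
  (cong (λ o → sumTo j λ b → (F i b · G o (j ∸ b)) k) (ℕₚ.n∸n≡0 i))

⊗-constant : ∀ F {G} → NoX G → NoY G → ∀ i j → (F ⊗ G) i j ≗ F i j · G 0 0
⊗-constant F {G} G-NoX G-NoY i j k = trans (⊗-NoX-right F {G} G-NoX i j k) (trans
  (sumTo-last j λ b b<j → ·-zero-right (F i b) (NoY-∸ {G} G-NoY 0 b<j) k)
  (cong (λ o → (F i j · G 0 o) k) (ℕₚ.n∸n≡0 j)))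

-- All of x^i must come from F and all of y^j from G, so one term of the double convolution
-- survives.
⊗-separate : ∀ {F G} → NoY F → NoX G → ∀ i j → (F ⊗ G) i j ≗ F i 0 · G 0 j
⊗-separate {F} {G} F-NoY G-NoX i j k = trans (⊗-NoX-right F {G} G-NoX i j k)
  (sumTo-head j λ b → ·-zero-left (G 0 (j ∸ suc b)) (F-NoY i b) k)

-- Euler's expansion of the left-hand side

geom-NoX : ∀ b c → NoX (geom 0 b c)
geom-NoX b c i j k = sumTo-zero k λ _ _ → refl

geom-NoY : ∀ a c → NoY (geom a 0 c)
geom-NoY a c i j k = sumTo-zero k λ m _ → cong ind (∧-zeroʳ (i ≡ᵇ a ℕ.* m))

one-NoX : NoX one
one-NoX i j k = refl

one-NoY : NoY one
one-NoY i j k = cong ind (∧-zeroʳ (i ≡ᵇ 0))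

invPoch-NoX : ∀ b e d n → NoX (invPoch 0 b e d n)
invPoch-NoX b e d zero    = one-NoX
invPoch-NoX b e d (suc n) = ⊗-NoX {invPoch 0 b e d n} {geom 0 b (e ℕ.+ d ℕ.* n)}
  (invPoch-NoX b e d n) (geom-NoX b (e ℕ.+ d ℕ.* n))

invPoch-NoY : ∀ a e d n → NoY (invPoch a 0 e d n)
invPoch-NoY a e d zero    = one-NoY
invPoch-NoY a e d (suc n) = ⊗-NoY {invPoch a 0 e d n} {geom a 0 (e ℕ.+ d ℕ.* n)}
  (invPoch-NoY a e d n) (geom-NoY a (e ℕ.+ d ℕ.* n))

-- Only m = i can contribute. If it lies outside the range, then k < i ≤ ci and the right side
-- vanishes too. The form serves both 1/(1-xq^c) and 1/(1-yq^c).
geom-single : ∀ c .{{_ : NonZero c}} i k →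
  sumTo k (λ m → ind ((i ≡ᵇ 1 ℕ.* m) ∧ (k ≡ᵇ c ℕ.* m))) ≡ (q^ (c ℕ.* i)) k
geom-single c i k with ℕₚ.<-≤-connex k i
... | inj₁ k<i = trans
  (sumTo-zero k λ m m≤k → cong (λ b → ind (b ∧ (k ≡ᵇ c ℕ.* m)))
    (≢⇒≡ᵇ-false (≢-sym (ℕₚ.<⇒≢ (subst (_< i) (sym (ℕₚ.*-identityˡ m)) (ℕₚ.≤-<-trans m≤k k<i))))))
  (sym (q^-low (ℕₚ.<-≤-trans k<i (ℕₚ.m≤n*m i c))))
... | inj₂ i≤k = trans
  (sumTo-single i≤k λ m m≢i → cong (λ b → ind (b ∧ (k ≡ᵇ c ℕ.* m)))
    (≢⇒≡ᵇ-false λ i≡ → m≢i (sym (trans i≡ (ℕₚ.*-identityˡ m)))))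
  (cong (λ b → ind (b ∧ (k ≡ᵇ c ℕ.* i)))
    (trans (cong (i ≡ᵇ_) (ℕₚ.*-identityˡ i)) (≡ᵇ-refl i)))

-- The hypothesis says that the generating functions satisfy g(z) = f(z)/(1-zq^c); the conclusion is
-- (1-zq^c) g(z) = f(z).
q^-convolution-suc : ∀ c (f : ℕ → Series) (g : ℕ → Series) →
  (∀ i → g i ≗ λ k → sumTo i λ a → (f a · q^ (c ℕ.* (i ∸ a))) k) →
  ∀ i → g (suc i) ≗ f (suc i) ⊞ q^ c · g i
q^-convolution-suc c f g g≗ i k = begin
  g (suc i) k
    ≡⟨ g≗ (suc i) k ⟩
  sumTo i (λ a → (f a · q^ (c ℕ.* (suc i ∸ a))) k) ℤ.+ (f (suc i) · q^ (c ℕ.* (i ∸ i))) k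
    ≡⟨ cong₂ ℤ._+_ (sumTo-cong≤ i λ a a≤i → step a a≤i k) last ⟩
  sumTo i (λ a → (q^ c · (f a · q^ (c ℕ.* (i ∸ a)))) k) ℤ.+ f (suc i) k
    ≡⟨ cong (ℤ._+ f (suc i) k) (sym (·-sumTo i (q^ c) (λ a → f a · q^ (c ℕ.* (i ∸ a))) k)) ⟩
  (q^ c · (λ k → sumTo i λ a → (f a · q^ (c ℕ.* (i ∸ a))) k)) k ℤ.+ f (suc i) k
    ≡⟨ cong (ℤ._+ f (suc i) k) (·-congˡ (q^ c) (≗-sym (g≗ i)) k) ⟩
  (q^ c · g i) k ℤ.+ f (suc i) k
    ≡⟨ ℤₚ.+-comm ((q^ c · g i) k) (f (suc i) k) ⟩
  f (suc i) k ℤ.+ (q^ c · g i) k ∎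
  where
  open ≡-Reasoning
  last : (f (suc i) · q^ (c ℕ.* (i ∸ i))) k ≡ f (suc i) k
  last = trans
    (·-congˡ (f (suc i)) (q^-cong (trans (cong (c ℕ.*_) (ℕₚ.n∸n≡0 i)) (ℕₚ.*-zeroʳ c))) k)
    (·-identityʳ (f (suc i)) k)
  step : ∀ a → a ≤ i → f a · q^ (c ℕ.* (suc i ∸ a)) ≗ q^ c · (f a · q^ (c ℕ.* (i ∸ a)))
  step a a≤i = ≗-trans
    (·-congˡ (f a) (≗-trans
      (q^-cong (trans (cong (c ℕ.*_) (ℕₚ.+-∸-assoc 1 a≤i)) (ℕₚ.*-suc c (i ∸ a))))
      (≗-sym (q^-· c (c ℕ.* (i ∸ a))))))
    (solve 3 (λ f x y → f :* (x :* y) := x :* (f :* y)) ≗-refl (f a) (q^ c) (q^ (c ℕ.* (i ∸ a))))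

module _ (e d : ℕ) .{{_ : NonZero e}} .{{_ : NonZero d}} where

  private
    c : ℕ → ℕ
    c n = e ℕ.+ d ℕ.* n

    c≢0 : ∀ n → NonZero (c n)
    c≢0 n = ℕ.>-nonZero (ℕₚ.<-≤-trans (ℕ.>-nonZero⁻¹ e) (ℕₚ.m≤m+n e (d ℕ.* n)))

    invPochX invPochY : ℕ → ℕ → Series
    invPochX n i = invPoch 1 0 e d n i 0
    invPochY n j = invPoch 0 1 e d n 0 j

    invPochX-convolution : ∀ n i →
      invPochX (suc n) i ≗ λ k → sumTo i λ a → (invPochX n a · q^ (c n ℕ.* (i ∸ a))) k
    invPochX-convolution n i k = sumTo-cong i λ a →
      ·-congˡ (invPochX n a) (geom-single (c n) {{c≢0 n}} (i ∸ a)) k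

    invPochY-convolution : ∀ n j →
      invPochY (suc n) j ≗ λ k → sumTo j λ b → (invPochY n b · q^ (c n ℕ.* (j ∸ b))) k
    invPochY-convolution n j k = sumTo-cong j λ b →
      ·-congˡ (invPochY n b) (geom-single (c n) {{c≢0 n}} (j ∸ b)) k

    constant-term : (E : ℕ → ℕ → Series) →
      (∀ n → E (suc n) 0 ≗ E n 0 · q^ (c n ℕ.* 0)) → E 0 0 ≗ q^ 0 → ∀ n → E n 0 ≗ q^ 0
    constant-term E E-suc E-zero zero    = E-zero
    constant-term E E-suc E-zero (suc n) = ≗-trans (E-suc n) (≗-trans
      (·-cong (constant-term E E-suc E-zero n) (q^-cong (ℕₚ.*-zeroʳ (c n)))) (·-identityˡ (q^ 0)))

  -- At q^k the infinite product is represented by its first k+1 factors, so `E-limit` is applied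
  -- with N = k.
  invPochInf-x : ∀ i → invPochInf 1 0 e d i 0 ≗ q^ (e ℕ.* i) · invPoch₀ d i
  invPochInf-x i k = Euler.E-limit e d invPochX
    (constant-term invPochX (λ n → invPochX-convolution n 0) ≗-refl)
    (λ i k → refl)
    (λ n → q^-convolution-suc (c n) (invPochX n) (invPochX (suc n)) (invPochX-convolution n))
    k i k ℕₚ.≤-refl

  invPochInf-y : ∀ j → invPochInf 0 1 e d 0 j ≗ q^ (e ℕ.* j) · invPoch₀ d j
  invPochInf-y j k = Euler.E-limit e d invPochY
    (constant-term invPochY (λ n → invPochY-convolution n 0) ≗-refl)
    (λ j k → refl)
    (λ n → q^-convolution-suc (c n) (invPochY n) (invPochY (suc n)) (invPochY-convolution n))
    k j k ℕₚ.≤-refl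

LHS-coefficient : ∀ i j →
  LHS i j ≗ (q^ (1 ℕ.* i) · invPoch₀ 2 i) · (q^ (2 ℕ.* j) · invPoch₀ 4 j)
LHS-coefficient i j = ≗-trans
  (⊗-separate {invPochInf 1 0 1 2} {invPochInf 0 1 2 4}
    (λ i j k → invPoch-NoY 1 1 2 (suc k) i j k) (λ i j k → invPoch-NoX 1 2 4 (suc k) i j k) i j)
  (·-cong (invPochInf-x 1 2 i) (invPochInf-y 2 4 j))

-- Monomials and the shape of a summand

mono-separate : ∀ a b c i j k → mono a b c i j k ≡ (q^ a) i ℤ.* ((q^ b) j ℤ.* (q^ c) k)
mono-separate a b c i j k = trans (ind-∧ (i ≡ᵇ a) _)
  (cong (ℤ._*_ ((q^ a) i)) (ind-∧ (j ≡ᵇ b) (k ≡ᵇ c)))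

-- Each monomial is a product of three one-variable indicators, so the triple convolution factors
-- into three products of powers; `q^_` stands for a power of any of the three variables.
mono-⊗ : ∀ a b c a′ b′ c′ → mono a b c ⊗ mono a′ b′ c′ ≐ mono (a ℕ.+ a′) (b ℕ.+ b′) (c ℕ.+ c′)
mono-⊗ a b c a′ b′ c′ i j k = begin
  (mono a b c ⊗ mono a′ b′ c′) i j k
    ≡⟨ (sumTo-cong i λ α → sumTo-cong j λ β → sumTo-cong k λ γ → trans
         (cong₂ ℤ._*_ (mono-separate a b c α β γ) (mono-separate a′ b′ c′ (i ∸ α) (j ∸ β) (k ∸ γ)))
         (*-interchange₃ ((q^ a) α) ((q^ b) β) ((q^ c) γ)
           ((q^ a′) (i ∸ α)) ((q^ b′) (j ∸ β)) ((q^ c′) (k ∸ γ)))) ⟩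
  sumTo i (λ α → sumTo j λ β → sumTo k λ γ → A α ℤ.* (B β ℤ.* C γ))
    ≡⟨ (sumTo-cong i λ α → sumTo-cong j λ β → trans
         (sumTo-*ˡ k (A α) (λ γ → B β ℤ.* C γ)) (cong (ℤ._*_ (A α)) (sumTo-*ˡ k (B β) C))) ⟩
  sumTo i (λ α → sumTo j λ β → A α ℤ.* (B β ℤ.* sumTo k C))
    ≡⟨ (sumTo-cong i λ α → trans
         (sumTo-*ˡ j (A α) (λ β → B β ℤ.* sumTo k C)) (cong (ℤ._*_ (A α)) (sumTo-*ʳ j (sumTo k C) B))) ⟩
  sumTo i (λ α → A α ℤ.* (sumTo j B ℤ.* sumTo k C))
    ≡⟨ sumTo-*ʳ i (sumTo j B ℤ.* sumTo k C) A ⟩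
  (q^ a · q^ a′) i ℤ.* ((q^ b · q^ b′) j ℤ.* (q^ c · q^ c′) k)
    ≡⟨ cong₂ ℤ._*_ (q^-· a a′ i) (cong₂ ℤ._*_ (q^-· b b′ j) (q^-· c c′ k)) ⟩
  (q^ (a ℕ.+ a′)) i ℤ.* ((q^ (b ℕ.+ b′)) j ℤ.* (q^ (c ℕ.+ c′)) k)
    ≡⟨ sym (mono-separate (a ℕ.+ a′) (b ℕ.+ b′) (c ℕ.+ c′) i j k) ⟩
  mono (a ℕ.+ a′) (b ℕ.+ b′) (c ℕ.+ c′) i j k ∎
  where
  open ≡-Reasoning
  A B C : ℕ → ℤ
  A α = (q^ a) α ℤ.* (q^ a′) (i ∸ α)
  B β = (q^ b) β ℤ.* (q^ b′) (j ∸ β)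
  C γ = (q^ c) γ ℤ.* (q^ c′) (k ∸ γ)

⊗-distribˡ-⊕ : ∀ F G H i j k → (F ⊗ (G ⊕ H)) i j k ≡ (F ⊗ G) i j k ℤ.+ (F ⊗ H) i j k
⊗-distribˡ-⊕ F G H i j k = trans
  (sumTo-cong i λ a → trans
    (sumTo-cong j λ b → CommutativeSemiring.distribˡ series-commutativeSemiring
      (F a b) (G (i ∸ a) (j ∸ b)) (H (i ∸ a) (j ∸ b)) k)
    (sumTo-+ j (λ b → (F a b · G (i ∸ a) (j ∸ b)) k) (λ b → (F a b · H (i ∸ a) (j ∸ b)) k)))
  (sumTo-+ i (λ a → sumTo j λ b → (F a b · G (i ∸ a) (j ∸ b)) k)
    (λ a → sumTo j λ b → (F a b · H (i ∸ a) (j ∸ b)) k))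

mono-cong : ∀ {a a′ b b′ c c′} → a ≡ a′ → b ≡ b′ → c ≡ c′ → ∀ i j → mono a b c i j ≗ mono a′ b′ c′ i j
mono-cong refl refl refl i j = ≗-refl

q^-·-mono : ∀ m a b c i j → q^ m · mono a b c i j ≗ mono a b (m ℕ.+ c) i j
q^-·-mono m a b c i j = gated (i ≡ᵇ a) (j ≡ᵇ b)
  where
  gated : ∀ p r → q^ m · (λ k → ind (p ∧ r ∧ (k ≡ᵇ c))) ≗ λ k → ind (p ∧ r ∧ (k ≡ᵇ m ℕ.+ c))
  gated true  true  = q^-· m c
  gated true  false = ·-zeroʳ (q^ m)
  gated false r     = ·-zeroʳ (q^ m)

mono-low : ∀ a b c i j {k} → k < c → mono a b c i j k ≡ + 0
mono-low a b c i j {k} k<c = gated (i ≡ᵇ a) (j ≡ᵇ b)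
  where
  gated : ∀ p r → ind (p ∧ r ∧ (k ≡ᵇ c)) ≡ + 0
  gated true  true  = q^-low k<c
  gated true  false = refl
  gated false r     = refl

·-low : ∀ {c f} g → (∀ {k} → k < c → f k ≡ + 0) → ∀ {k} → k < c → (f · g) k ≡ + 0
·-low g f-low {k} k<c = sumTo-zero k λ t t≤k →
  cong (ℤ._* g (k ∸ t)) (f-low (ℕₚ.≤-<-trans t≤k k<c))

-- A monomial times four reciprocals, nested to the left as in `term`.
prod : Series → Series → Series → Series → Series → Series
prod m f g h l = m · f · g · h · l

prod-congˡ : ∀ f g h l {m m′} → m ≗ m′ → prod m f g h l ≗ prod m′ f g h l
prod-congˡ f g h l m≗ = ·-congʳ l (·-congʳ h (·-congʳ g (·-congʳ f m≗)))

prod-zeroˡ : ∀ f g h l {m} → m ≗ 𝟘 → prod m f g h l ≗ 𝟘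
prod-zeroˡ f g h l m≗𝟘 =
  ·-zero-left l (·-zero-left h (·-zero-left g (·-zero-left f m≗𝟘)))

prod-low : ∀ {c m} f g h l → (∀ {k} → k < c → m k ≡ + 0) → ∀ {k} → k < c → prod m f g h l k ≡ + 0
prod-low f g h l m-low = ·-low l (·-low h (·-low g (·-low f m-low)))

prod-distribˡ : ∀ m m′ f g h l → prod (m ⊞ m′) f g h l ≗ prod m f g h l ⊞ prod m′ f g h l
prod-distribˡ = solve 6 (λ m m′ f g h l →
  (m :+ m′) :* f :* g :* h :* l := m :* f :* g :* h :* l :+ m′ :* f :* g :* h :* l) ≗-refl

prod-·ˡ : ∀ s m f g h l → s · prod m f g h l ≗ prod (s · m) f g h l
prod-·ˡ = solve 6 (λ s m f g h l →
  s :* (m :* f :* g :* h :* l) := (s :* m) :* f :* g :* h :* l) ≗-refl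

-- Distributivity, with the factor s moved onto the monomial, where it will change only the exponent
-- of q.
prod-split₁ : ∀ s m g h l f f′ → f ≗ f′ ⊞ s · f →
  prod m f g h l ≗ prod (s · m) f g h l ⊞ prod m f′ g h l
prod-split₁ s m g h l f f′ f≗ = ≗-trans
  (·-congʳ l (·-congʳ h (·-congʳ g (·-congˡ m f≗))))
  (solve 7 (λ s m g h l f f′ → m :* (f′ :+ s :* f) :* g :* h :* l :=
     (s :* m) :* f :* g :* h :* l :+ m :* f′ :* g :* h :* l) ≗-refl s m g h l f f′)

prod-split₂ : ∀ s m f h l g g′ → g ≗ g′ ⊞ s · g →
  prod m f g h l ≗ prod (s · m) f g h l ⊞ prod m f g′ h l
prod-split₂ s m f h l g g′ g≗ = ≗-trans
  (·-congʳ l (·-congʳ h (·-congˡ (m · f) g≗)))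
  (solve 7 (λ s m f h l g g′ → m :* f :* (g′ :+ s :* g) :* h :* l :=
     (s :* m) :* f :* g :* h :* l :+ m :* f :* g′ :* h :* l) ≗-refl s m f h l g g′)

prod-split₃ : ∀ s m f g l h h′ → h ≗ h′ ⊞ s · h →
  prod m f g h l ≗ prod (s · m) f g h l ⊞ prod m f g h′ l
prod-split₃ s m f g l h h′ h≗ = ≗-trans
  (·-congʳ l (·-congˡ (m · f · g) h≗))
  (solve 7 (λ s m f g l h h′ → m :* f :* g :* (h′ :+ s :* h) :* l :=
     (s :* m) :* f :* g :* h :* l :+ m :* f :* g :* h′ :* l) ≗-refl s m f g l h h′)

prod-split₄ : ∀ s m f g h l l′ → l ≗ l′ ⊞ s · l →
  prod m f g h l ≗ prod (s · m) f g h l ⊞ prod m f g h l′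
prod-split₄ s m f g h l l′ l≗ = ≗-trans
  (·-congˡ (m · f · g · h) l≗)
  (solve 7 (λ s m f g h l l′ → m :* f :* g :* h :* (l′ :+ s :* l) :=
     (s :* m) :* f :* g :* h :* l :+ m :* f :* g :* h :* l′) ≗-refl s m f g h l l′)

-- Fourfold sums with a fixed cutoff

Family : Set
Family = ℕ → ℕ → ℕ → ℕ → ℤ

Σ⁴ : ℕ → Family → ℤ
Σ⁴ N T = sumTo N λ n₁ → sumTo N λ n₂ → sumTo N λ n₃ → sumTo N λ n₄ → T n₁ n₂ n₃ n₄

Σ⁴-cong : ∀ N {T U : Family} → (∀ n₁ n₂ n₃ n₄ → T n₁ n₂ n₃ n₄ ≡ U n₁ n₂ n₃ n₄) → Σ⁴ N T ≡ Σ⁴ N U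
Σ⁴-cong N T≡U = sumTo-cong N λ n₁ → sumTo-cong N λ n₂ → sumTo-cong N λ n₃ → sumTo-cong N λ n₄ →
  T≡U n₁ n₂ n₃ n₄

Σ⁴-+ : ∀ N (T U : Family) →
  Σ⁴ N (λ n₁ n₂ n₃ n₄ → T n₁ n₂ n₃ n₄ ℤ.+ U n₁ n₂ n₃ n₄) ≡ Σ⁴ N T ℤ.+ Σ⁴ N U
Σ⁴-+ N T U = trans
  (sumTo-cong N λ n₁ → trans
    (sumTo-cong N λ n₂ → trans
      (sumTo-cong N λ n₃ → sumTo-+ N (T n₁ n₂ n₃) (U n₁ n₂ n₃))
      (sumTo-+ N (λ n₃ → sumTo N (T n₁ n₂ n₃)) (λ n₃ → sumTo N (U n₁ n₂ n₃))))
    (sumTo-+ N (λ n₂ → sumTo N λ n₃ → sumTo N (T n₁ n₂ n₃)) (λ n₂ → sumTo N λ n₃ → sumTo N (U n₁ n₂ n₃))))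
  (sumTo-+ N (λ n₁ → sumTo N λ n₂ → sumTo N λ n₃ → sumTo N (T n₁ n₂ n₃))
    (λ n₁ → sumTo N λ n₂ → sumTo N λ n₃ → sumTo N (U n₁ n₂ n₃)))

·-Σ⁴ : ∀ N f (T : ℕ → ℕ → ℕ → ℕ → Series) →
  f · (λ k → Σ⁴ N λ n₁ n₂ n₃ n₄ → T n₁ n₂ n₃ n₄ k) ≗
  λ k → Σ⁴ N λ n₁ n₂ n₃ n₄ → (f · T n₁ n₂ n₃ n₄) k
·-Σ⁴ N f T k = trans (·-sumTo N f (λ n₁ k → sumTo N λ n₂ → sumTo N λ n₃ → sumTo N λ n₄ → T n₁ n₂ n₃ n₄ k) k)
  (sumTo-cong N λ n₁ → trans (·-sumTo N f (λ n₂ k → sumTo N λ n₃ → sumTo N λ n₄ → T n₁ n₂ n₃ n₄ k) k)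
  (sumTo-cong N λ n₂ → trans (·-sumTo N f (λ n₃ k → sumTo N λ n₄ → T n₁ n₂ n₃ n₄ k) k)
  (sumTo-cong N λ n₃ → ·-sumTo N f (λ n₄ → T n₁ n₂ n₃ n₄) k)))

module _ (N : ℕ) (T U : Family) where

  -- In the contiguous relations the vanishing at 0 comes from `invPoch₀-pred`, and the vanishing at
  -- N from the q-order of the summand.
  Σ⁴-shift₁ : (∀ n₂ n₃ n₄ → T 0 n₂ n₃ n₄ ≡ + 0) →
    (∀ n₁ n₂ n₃ n₄ → T (suc n₁) n₂ n₃ n₄ ≡ U n₁ n₂ n₃ n₄) →
    (∀ n₂ n₃ n₄ → U N n₂ n₃ n₄ ≡ + 0) → Σ⁴ N T ≡ Σ⁴ N U
  Σ⁴-shift₁ T0≡0 Ts≡U UN≡0 = sumTo-shift N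
    (sumTo-zero N λ n₂ _ → sumTo-zero N λ n₃ _ → sumTo-zero N λ n₄ _ → T0≡0 n₂ n₃ n₄)
    (λ n₁ → sumTo-cong N λ n₂ → sumTo-cong N λ n₃ → sumTo-cong N λ n₄ → Ts≡U n₁ n₂ n₃ n₄)
    (sumTo-zero N λ n₂ _ → sumTo-zero N λ n₃ _ → sumTo-zero N λ n₄ _ → UN≡0 n₂ n₃ n₄)

  Σ⁴-shift₂ : (∀ n₁ n₃ n₄ → T n₁ 0 n₃ n₄ ≡ + 0) →
    (∀ n₁ n₂ n₃ n₄ → T n₁ (suc n₂) n₃ n₄ ≡ U n₁ n₂ n₃ n₄) →
    (∀ n₁ n₃ n₄ → U n₁ N n₃ n₄ ≡ + 0) → Σ⁴ N T ≡ Σ⁴ N U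
  Σ⁴-shift₂ T0≡0 Ts≡U UN≡0 = sumTo-cong N λ n₁ → sumTo-shift N
    (sumTo-zero N λ n₃ _ → sumTo-zero N λ n₄ _ → T0≡0 n₁ n₃ n₄)
    (λ n₂ → sumTo-cong N λ n₃ → sumTo-cong N λ n₄ → Ts≡U n₁ n₂ n₃ n₄)
    (sumTo-zero N λ n₃ _ → sumTo-zero N λ n₄ _ → UN≡0 n₁ n₃ n₄)

  Σ⁴-shift₃ : (∀ n₁ n₂ n₄ → T n₁ n₂ 0 n₄ ≡ + 0) →
    (∀ n₁ n₂ n₃ n₄ → T n₁ n₂ (suc n₃) n₄ ≡ U n₁ n₂ n₃ n₄) →
    (∀ n₁ n₂ n₄ → U n₁ n₂ N n₄ ≡ + 0) → Σ⁴ N T ≡ Σ⁴ N U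
  Σ⁴-shift₃ T0≡0 Ts≡U UN≡0 = sumTo-cong N λ n₁ → sumTo-cong N λ n₂ → sumTo-shift N
    (sumTo-zero N λ n₄ _ → T0≡0 n₁ n₂ n₄)
    (λ n₃ → sumTo-cong N λ n₄ → Ts≡U n₁ n₂ n₃ n₄)
    (sumTo-zero N λ n₄ _ → UN≡0 n₁ n₂ n₄)

  Σ⁴-shift₄ : (∀ n₁ n₂ n₃ → T n₁ n₂ n₃ 0 ≡ + 0) →
    (∀ n₁ n₂ n₃ n₄ → T n₁ n₂ n₃ (suc n₄) ≡ U n₁ n₂ n₃ n₄) →
    (∀ n₁ n₂ n₃ → U n₁ n₂ n₃ N ≡ + 0) → Σ⁴ N T ≡ Σ⁴ N U
  Σ⁴-shift₄ T0≡0 Ts≡U UN≡0 = sumTo-cong N λ n₁ → sumTo-cong N λ n₂ → sumTo-cong N λ n₃ →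
    sumTo-shift N (T0≡0 n₁ n₂ n₃) (Ts≡U n₁ n₂ n₃) (UN≡0 n₁ n₂ n₃)

-- Contiguous relations

-- The x^i y^j-coefficient of a single term of x^a y^b q^c T(t₁,t₂,t₃,t₄).
summand : (a b c t₁ t₂ t₃ t₄ n₁ n₂ n₃ n₄ : ℕ) → ℕ → ℕ → Series
summand a b c t₁ t₂ t₃ t₄ n₁ n₂ n₃ n₄ i j =
  prod (mono (xExp a n₁ n₂ n₄) (yExp b n₂ n₃) (qExp c t₁ t₂ t₃ t₄ n₁ n₂ n₃ n₄) i j)
    (invPoch₀ 2 n₁) (invPoch₀ 2 n₂) (invPoch₀ 4 n₃) (invPoch₀ 4 n₄)

-- The x^i y^j-coefficient of x^a y^b q^c T(t₁,t₂,t₃,t₄), with all indices cut off at N.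
-- The cutoff does not depend on the power of q that is read off, so that multiplication
-- by a series commutes with the sum; only the coefficients of q^k with k ≤ N are meaningful.
Z : (N a b c t₁ t₂ t₃ t₄ : ℕ) → ℕ → ℕ → Series
Z N a b c t₁ t₂ t₃ t₄ i j k =
  Σ⁴ N λ n₁ n₂ n₃ n₄ → summand a b c t₁ t₂ t₃ t₄ n₁ n₂ n₃ n₄ i j k

qExp-low : ∀ s r {n e} .{{_ : NonZero s}} → e ≡ s ℕ.* suc n ℕ.+ r → ∀ {k} → k ≤ n → k < e
qExp-low s r {n} refl k≤n =
  ℕₚ.≤-trans (s≤s k≤n) (ℕₚ.≤-trans (ℕₚ.m≤n*m (suc n) s) (ℕₚ.m≤m+n (s ℕ.* suc n) r))

module Contiguous (N a b c t₁ t₂ t₃ t₄ i j : ℕ) where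

  private
    x y z : (n₁ n₂ n₃ n₄ : ℕ) → ℕ
    x n₁ n₂ n₃ n₄ = xExp a n₁ n₂ n₄
    y n₁ n₂ n₃ n₄ = yExp b n₂ n₃
    z = qExp c t₁ t₂ t₃ t₄
    M : (n₁ n₂ n₃ n₄ : ℕ) → Series
    M n₁ n₂ n₃ n₄ = mono (x n₁ n₂ n₃ n₄) (y n₁ n₂ n₃ n₄) (z n₁ n₂ n₃ n₄) i j

    P P⁻ R R⁻ : ℕ → Series
    P = invPoch₀ 2
    P⁻ = invPoch₀-pred 2
    R = invPoch₀ 4
    R⁻ = invPoch₀-pred 4

  -- Apply `invPoch₀-rec` to 1/(q²;q²)_{n₁}: the part with q^{2n₁} raises t₁ by 2, and the part with
  -- 1/(q²;q²)_{n₁-1} is reindexed by n₁+1. The other three relations follow the same pattern.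
  Z-contiguous₁ : .{{_ : NonZero t₁}} →
    Z N a b c t₁ t₂ t₃ t₄ i j ≈[ N ]
    Z N a b c (2 ℕ.+ t₁) t₂ t₃ t₄ i j ⊞
    Z N (1 ℕ.+ a) b (c ℕ.+ t₁) (2 ℕ.+ t₁) (2 ℕ.+ t₂) (4 ℕ.+ t₃) t₄ i j
  Z-contiguous₁ k k≤N = trans
    (Σ⁴-cong N λ n₁ n₂ n₃ n₄ → trans
      (prod-split₁ (q^ (2 ℕ.* n₁)) (M n₁ n₂ n₃ n₄) (P n₂) (R n₃) (R n₄) (P n₁) (P⁻ n₁)
        (invPoch₀-rec 2 n₁) k)
      (cong (ℤ._+ T n₁ n₂ n₃ n₄) (prod-congˡ (P n₁) (P n₂) (R n₃) (R n₄) (≗-trans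
        (q^-·-mono (2 ℕ.* n₁) (x n₁ n₂ n₃ n₄) (y n₁ n₂ n₃ n₄) (z n₁ n₂ n₃ n₄) i j)
        (mono-cong refl refl (qExp-raise₁ c t₁ t₂ t₃ t₄ n₁ n₂ n₃ n₄ (n₁ C 2)) i j)) k)))
    (trans (Σ⁴-+ N (λ n₁ n₂ n₃ n₄ → summand a b c (2 ℕ.+ t₁) t₂ t₃ t₄ n₁ n₂ n₃ n₄ i j k) T)
      (cong (ℤ._+_ (Z N a b c (2 ℕ.+ t₁) t₂ t₃ t₄ i j k)) (Σ⁴-shift₁ N T U
        -- The term n₁ = 0 vanishes by the convention for `invPoch₀-pred`.
        (λ n₂ n₃ n₄ → (·-zero-left (R n₄) (·-zero-left (R n₃) (·-zero-left (P n₂) (·-zeroʳ (M 0 n₂ n₃ n₄))))) k)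
        (λ n₁ n₂ n₃ n₄ → prod-congˡ (P n₁) (P n₂) (R n₃) (R n₄)
          (mono-cong (ℕₚ.+-suc a (n₁ ℕ.+ n₂ ℕ.+ 2 ℕ.* n₄)) refl (trans (cong (qExp′ c t₁ t₂ t₃ t₄ (suc n₁) n₂ n₃ n₄) (nC2-suc n₁))
            (qExp-shift₁ c t₁ t₂ t₃ t₄ n₁ n₂ n₃ n₄ (n₁ C 2))) i j) k)
        -- The term n₁ = N, added by the reindexing, has q-order at least t₁(N+1) > N.
        (λ n₂ n₃ n₄ → prod-low (P N) (P n₂) (R n₃) (R n₄)
          (mono-low (xExp (1 ℕ.+ a) N n₂ n₄) (yExp b n₂ n₃) _ i j)
          (qExp-low t₁ _ (qExp-factor₁ c t₁ t₂ t₃ t₄ N n₂ n₃ n₄ (N C 2)) k≤N)))))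
    where
    T : Family
    T n₁ n₂ n₃ n₄ = prod (M n₁ n₂ n₃ n₄) (P⁻ n₁) (P n₂) (R n₃) (R n₄) k
    U : Family
    U n₁ n₂ n₃ n₄ = summand (1 ℕ.+ a) b (c ℕ.+ t₁) (2 ℕ.+ t₁) (2 ℕ.+ t₂) (4 ℕ.+ t₃) t₄ n₁ n₂ n₃ n₄ i j k

  -- Raising n₂ by one changes t₁ through 2n₁n₂; the exponent has no quadratic term in n₂, so t₂
  -- stays fixed.
  Z-contiguous₂ : .{{_ : NonZero t₂}} →
    Z N a b c t₁ t₂ t₃ t₄ i j ≈[ N ]
    Z N a b c t₁ (2 ℕ.+ t₂) t₃ t₄ i j ⊞
    Z N (1 ℕ.+ a) (1 ℕ.+ b) (c ℕ.+ t₂) (2 ℕ.+ t₁) t₂ t₃ t₄ i j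
  Z-contiguous₂ k k≤N = trans
    (Σ⁴-cong N λ n₁ n₂ n₃ n₄ → trans
      (prod-split₂ (q^ (2 ℕ.* n₂)) (M n₁ n₂ n₃ n₄) (P n₁) (R n₃) (R n₄) (P n₂) (P⁻ n₂)
        (invPoch₀-rec 2 n₂) k)
      (cong (ℤ._+ T n₁ n₂ n₃ n₄) (prod-congˡ (P n₁) (P n₂) (R n₃) (R n₄) (≗-trans
        (q^-·-mono (2 ℕ.* n₂) (x n₁ n₂ n₃ n₄) (y n₁ n₂ n₃ n₄) (z n₁ n₂ n₃ n₄) i j)
        (mono-cong refl refl (qExp-raise₂ c t₁ t₂ t₃ t₄ n₁ n₂ n₃ n₄ (n₁ C 2)) i j)) k)))
    (trans (Σ⁴-+ N (λ n₁ n₂ n₃ n₄ → summand a b c t₁ (2 ℕ.+ t₂) t₃ t₄ n₁ n₂ n₃ n₄ i j k) T)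
      (cong (ℤ._+_ (Z N a b c t₁ (2 ℕ.+ t₂) t₃ t₄ i j k)) (Σ⁴-shift₂ N T U
        (λ n₁ n₃ n₄ → (·-zero-left (R n₄) (·-zero-left (R n₃) (·-zeroʳ (M n₁ 0 n₃ n₄ · P n₁)))) k)
        (λ n₁ n₂ n₃ n₄ → prod-congˡ (P n₁) (P n₂) (R n₃) (R n₄)
          (mono-cong (xExp-suc₂ a n₁ n₂ n₄) (ℕₚ.+-suc b (n₂ ℕ.+ n₃)) (qExp-shift₂ c t₁ t₂ t₃ t₄ n₁ n₂ n₃ n₄ (n₁ C 2)) i j) k)
        (λ n₁ n₃ n₄ → prod-low (P n₁) (P N) (R n₃) (R n₄)
          (mono-low (xExp (1 ℕ.+ a) n₁ N n₄) (yExp (1 ℕ.+ b) N n₃) _ i j)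
          (qExp-low t₂ _ (qExp-factor₂ c t₁ t₂ t₃ t₄ n₁ N n₃ n₄ (n₁ C 2)) k≤N)))))
    where
    T : Family
    T n₁ n₂ n₃ n₄ = prod (M n₁ n₂ n₃ n₄) (P n₁) (P⁻ n₂) (R n₃) (R n₄) k
    U : Family
    U n₁ n₂ n₃ n₄ = summand (1 ℕ.+ a) (1 ℕ.+ b) (c ℕ.+ t₂) (2 ℕ.+ t₁) t₂ t₃ t₄ n₁ n₂ n₃ n₄ i j k

  -- Raising n₃ by one changes t₁ and t₄ through 4n₁n₃ and 4n₃n₄.
  Z-contiguous₃ : .{{_ : NonZero t₃}} →
    Z N a b c t₁ t₂ t₃ t₄ i j ≈[ N ]
    Z N a b c t₁ t₂ (4 ℕ.+ t₃) t₄ i j ⊞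
    Z N a (1 ℕ.+ b) (c ℕ.+ t₃) (4 ℕ.+ t₁) t₂ t₃ (4 ℕ.+ t₄) i j
  Z-contiguous₃ k k≤N = trans
    (Σ⁴-cong N λ n₁ n₂ n₃ n₄ → trans
      (prod-split₃ (q^ (4 ℕ.* n₃)) (M n₁ n₂ n₃ n₄) (P n₁) (P n₂) (R n₄) (R n₃) (R⁻ n₃)
        (invPoch₀-rec 4 n₃) k)
      (cong (ℤ._+ T n₁ n₂ n₃ n₄) (prod-congˡ (P n₁) (P n₂) (R n₃) (R n₄) (≗-trans
        (q^-·-mono (4 ℕ.* n₃) (x n₁ n₂ n₃ n₄) (y n₁ n₂ n₃ n₄) (z n₁ n₂ n₃ n₄) i j)
        (mono-cong refl refl (qExp-raise₃ c t₁ t₂ t₃ t₄ n₁ n₂ n₃ n₄ (n₁ C 2)) i j)) k)))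
    (trans (Σ⁴-+ N (λ n₁ n₂ n₃ n₄ → summand a b c t₁ t₂ (4 ℕ.+ t₃) t₄ n₁ n₂ n₃ n₄ i j k) T)
      (cong (ℤ._+_ (Z N a b c t₁ t₂ (4 ℕ.+ t₃) t₄ i j k)) (Σ⁴-shift₃ N T U
        (λ n₁ n₂ n₄ → (·-zero-left (R n₄) (·-zeroʳ (M n₁ n₂ 0 n₄ · P n₁ · P n₂))) k)
        (λ n₁ n₂ n₃ n₄ → prod-congˡ (P n₁) (P n₂) (R n₃) (R n₄)
          (mono-cong refl (yExp-suc₃ b n₂ n₃) (qExp-shift₃ c t₁ t₂ t₃ t₄ n₁ n₂ n₃ n₄ (n₁ C 2)) i j) k)
        (λ n₁ n₂ n₄ → prod-low (P n₁) (P n₂) (R N) (R n₄)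
          (mono-low (xExp a n₁ n₂ n₄) (yExp (1 ℕ.+ b) n₂ N) _ i j)
          (qExp-low t₃ _ (qExp-factor₃ c t₁ t₂ t₃ t₄ n₁ n₂ N n₄ (n₁ C 2)) k≤N)))))
    where
    T : Family
    T n₁ n₂ n₃ n₄ = prod (M n₁ n₂ n₃ n₄) (P n₁) (P n₂) (R⁻ n₃) (R n₄) k
    U : Family
    U n₁ n₂ n₃ n₄ = summand a (1 ℕ.+ b) (c ℕ.+ t₃) (4 ℕ.+ t₁) t₂ t₃ (4 ℕ.+ t₄) n₁ n₂ n₃ n₄ i j k

  -- Raising n₄ by one changes t₃ through 4n₃n₄ and brings in x².
  Z-contiguous₄ : .{{_ : NonZero t₄}} →
    Z N a b c t₁ t₂ t₃ t₄ i j ≈[ N ]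
    Z N a b c t₁ t₂ t₃ (4 ℕ.+ t₄) i j ⊞
    Z N (2 ℕ.+ a) b (c ℕ.+ t₄) t₁ t₂ (4 ℕ.+ t₃) t₄ i j
  Z-contiguous₄ k k≤N = trans
    (Σ⁴-cong N λ n₁ n₂ n₃ n₄ → trans
      (prod-split₄ (q^ (4 ℕ.* n₄)) (M n₁ n₂ n₃ n₄) (P n₁) (P n₂) (R n₃) (R n₄) (R⁻ n₄)
        (invPoch₀-rec 4 n₄) k)
      (cong (ℤ._+ T n₁ n₂ n₃ n₄) (prod-congˡ (P n₁) (P n₂) (R n₃) (R n₄) (≗-trans
        (q^-·-mono (4 ℕ.* n₄) (x n₁ n₂ n₃ n₄) (y n₁ n₂ n₃ n₄) (z n₁ n₂ n₃ n₄) i j)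
        (mono-cong refl refl (qExp-raise₄ c t₁ t₂ t₃ t₄ n₁ n₂ n₃ n₄ (n₁ C 2)) i j)) k)))
    (trans (Σ⁴-+ N (λ n₁ n₂ n₃ n₄ → summand a b c t₁ t₂ t₃ (4 ℕ.+ t₄) n₁ n₂ n₃ n₄ i j k) T)
      (cong (ℤ._+_ (Z N a b c t₁ t₂ t₃ (4 ℕ.+ t₄) i j k)) (Σ⁴-shift₄ N T U
        (λ n₁ n₂ n₃ → (·-zeroʳ (M n₁ n₂ n₃ 0 · P n₁ · P n₂ · R n₃)) k)
        (λ n₁ n₂ n₃ n₄ → prod-congˡ (P n₁) (P n₂) (R n₃) (R n₄)
          (mono-cong (xExp-suc₄ a n₁ n₂ n₄) refl (qExp-shift₄ c t₁ t₂ t₃ t₄ n₁ n₂ n₃ n₄ (n₁ C 2)) i j) k)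
        (λ n₁ n₂ n₃ → prod-low (P n₁) (P n₂) (R n₃) (R N)
          (mono-low (xExp (2 ℕ.+ a) n₁ n₂ N) (yExp b n₂ n₃) _ i j)
          (qExp-low t₄ _ (qExp-factor₄ c t₁ t₂ t₃ t₄ n₁ n₂ n₃ N (n₁ C 2)) k≤N)))))
    where
    T : Family
    T n₁ n₂ n₃ n₄ = prod (M n₁ n₂ n₃ n₄) (P n₁) (P n₂) (R n₃) (R⁻ n₄) k
    U : Family
    U n₁ n₂ n₃ n₄ = summand (2 ℕ.+ a) b (c ℕ.+ t₄) t₁ t₂ (4 ℕ.+ t₃) t₄ n₁ n₂ n₃ n₄ i j k

-- The right-hand side in terms of the sums T

term-coefficient : ∀ n₁ n₂ n₃ n₄ i j → term n₁ n₂ n₃ n₄ i j ≗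
  summand 0 0 0 1 3 2 2 n₁ n₂ n₃ n₄ i j ⊞ summand 2 1 4 5 3 6 2 n₁ n₂ n₃ n₄ i j
term-coefficient n₁ n₂ n₃ n₄ i j = begin
  term n₁ n₂ n₃ n₄ i j
    -- The four reciprocals involve q alone, so each acts on an x^i y^j-coefficient by
    -- multiplication in `Series`.
    ≈⟨ ⊗-invPoch 4 n₄ (mono a b c ⊗ (one ⊕ mono 2 1 s) ⊗ invPoch 0 0 2 2 n₁ ⊗ invPoch 0 0 2 2 n₂
         ⊗ invPoch 0 0 4 4 n₃) ⟩
  (mono a b c ⊗ (one ⊕ mono 2 1 s) ⊗ invPoch 0 0 2 2 n₁ ⊗ invPoch 0 0 2 2 n₂
    ⊗ invPoch 0 0 4 4 n₃) i j · R₄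
    ≈⟨ ·-congʳ R₄ (⊗-invPoch 4 n₃
         (mono a b c ⊗ (one ⊕ mono 2 1 s) ⊗ invPoch 0 0 2 2 n₁ ⊗ invPoch 0 0 2 2 n₂)) ⟩
  (mono a b c ⊗ (one ⊕ mono 2 1 s) ⊗ invPoch 0 0 2 2 n₁ ⊗ invPoch 0 0 2 2 n₂) i j · R₃ · R₄
    ≈⟨ ·-congʳ R₄ (·-congʳ R₃ (⊗-invPoch 2 n₂
         (mono a b c ⊗ (one ⊕ mono 2 1 s) ⊗ invPoch 0 0 2 2 n₁))) ⟩
  (mono a b c ⊗ (one ⊕ mono 2 1 s) ⊗ invPoch 0 0 2 2 n₁) i j · P₂ · R₃ · R₄
    ≈⟨ ·-congʳ R₄ (·-congʳ R₃ (·-congʳ P₂ (⊗-invPoch 2 n₁ (mono a b c ⊗ (one ⊕ mono 2 1 s))))) ⟩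
  prod ((mono a b c ⊗ (one ⊕ mono 2 1 s)) i j) P₁ P₂ R₃ R₄
    ≈⟨ prod-congˡ P₁ P₂ R₃ R₄ monomials ⟩
  prod (M ⊞ M′) P₁ P₂ R₃ R₄
    ≈⟨ prod-distribˡ M M′ P₁ P₂ R₃ R₄ ⟩
  summand 0 0 0 1 3 2 2 n₁ n₂ n₃ n₄ i j ⊞ summand 2 1 4 5 3 6 2 n₁ n₂ n₃ n₄ i j ∎
  where
  open ≗-Reasoning
  a = n₁ ℕ.+ n₂ ℕ.+ 2 ℕ.* n₄
  b = n₂ ℕ.+ n₃
  c = n₁ ℕ.+ 3 ℕ.* n₂ ℕ.+ 2 ℕ.* n₃ ℕ.+ 2 ℕ.* n₄
    ℕ.+ (2 ℕ.* (n₁ C 2) ℕ.+ 2 ℕ.* n₁ ℕ.* n₂ ℕ.+ 4 ℕ.* n₁ ℕ.* n₃ ℕ.+ 4 ℕ.* n₃ ℕ.* n₄)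
  s = 4 ℕ.+ 4 ℕ.* (n₁ ℕ.+ n₃)
  P₁ = invPoch₀ 2 n₁
  P₂ = invPoch₀ 2 n₂
  R₃ = invPoch₀ 4 n₃
  R₄ = invPoch₀ 4 n₄
  M = mono (xExp 0 n₁ n₂ n₄) (yExp 0 n₂ n₃) (qExp 0 1 3 2 2 n₁ n₂ n₃ n₄) i j
  M′ = mono (xExp 2 n₁ n₂ n₄) (yExp 1 n₂ n₃) (qExp 4 5 3 6 2 n₁ n₂ n₃ n₄) i j
  ⊗-invPoch : ∀ d n F → (F ⊗ invPoch 0 0 d d n) i j ≗ F i j · invPoch₀ d n
  ⊗-invPoch d n F = ⊗-constant F {invPoch 0 0 d d n} (invPoch-NoX 0 d d n) (invPoch-NoY 0 d d n) i j
  c≡ : c ≡ qExp 0 1 3 2 2 n₁ n₂ n₃ n₄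
  c≡ = term-exponent₁ n₁ n₂ n₃ n₄ (n₁ C 2)
  monomials : (mono a b c ⊗ (one ⊕ mono 2 1 s)) i j ≗ M ⊞ M′
  monomials k = trans (⊗-distribˡ-⊕ (mono a b c) one (mono 2 1 s) i j k) (cong₂ ℤ._+_
    (trans (mono-⊗ a b c 0 0 0 i j k) (mono-cong (ℕₚ.+-identityʳ a) (ℕₚ.+-identityʳ b)
      (trans (ℕₚ.+-identityʳ c) c≡) i j k))
    (trans (mono-⊗ a b c 2 1 s i j k) (mono-cong (ℕₚ.+-comm a 2) (ℕₚ.+-comm b 1)
      (trans (cong (ℕ._+ s) c≡) (term-exponent₂ n₁ n₂ n₃ n₄ (n₁ C 2))) i j k)))

-- Multiplication by xq and the substitution of xq² for x

q^-·-summand : ∀ m a b c t₁ t₂ t₃ t₄ n₁ n₂ n₃ n₄ i j →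
  q^ m · summand a b c t₁ t₂ t₃ t₄ n₁ n₂ n₃ n₄ i j ≗
  prod (mono (xExp a n₁ n₂ n₄) (yExp b n₂ n₃) (m ℕ.+ qExp c t₁ t₂ t₃ t₄ n₁ n₂ n₃ n₄) i j)
    (invPoch₀ 2 n₁) (invPoch₀ 2 n₂) (invPoch₀ 4 n₃) (invPoch₀ 4 n₄)
q^-·-summand m a b c t₁ t₂ t₃ t₄ n₁ n₂ n₃ n₄ i j = ≗-trans
  (prod-·ˡ (q^ m) (mono x y z i j) (invPoch₀ 2 n₁) (invPoch₀ 2 n₂) (invPoch₀ 4 n₃) (invPoch₀ 4 n₄))
  (prod-congˡ (invPoch₀ 2 n₁) (invPoch₀ 2 n₂) (invPoch₀ 4 n₃) (invPoch₀ 4 n₄)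
    (q^-·-mono m x y z i j))
  where
  x = xExp a n₁ n₂ n₄
  y = yExp b n₂ n₃
  z = qExp c t₁ t₂ t₃ t₄ n₁ n₂ n₃ n₄

Z-xq-shift : ∀ N a b c t₁ t₂ t₃ t₄ i j →
  Z N (suc a) b (suc c) t₁ t₂ t₃ t₄ (suc i) j ≗ q^ 1 · Z N a b c t₁ t₂ t₃ t₄ i j
Z-xq-shift N a b c t₁ t₂ t₃ t₄ i j k = sym (trans
  (·-Σ⁴ N (q^ 1) (λ n₁ n₂ n₃ n₄ → summand a b c t₁ t₂ t₃ t₄ n₁ n₂ n₃ n₄ i j) k)
  (Σ⁴-cong N λ n₁ n₂ n₃ n₄ → q^-·-summand 1 a b c t₁ t₂ t₃ t₄ n₁ n₂ n₃ n₄ i j k))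

-- On the support of the monomial i = a, so that the substitution x ↦ xq² acts on the
-- x^i-coefficient as multiplication by q^{2i}.
q^-·-mono-x : ∀ a b c i j → q^ (2 ℕ.* i) · mono a b c i j ≗ mono a b (2 ℕ.* a ℕ.+ c) i j
q^-·-mono-x a b c i j with i ℕ.≟ a
... | yes refl = q^-·-mono (2 ℕ.* i) i b c i j
... | no i≢a rewrite ≢⇒≡ᵇ-false i≢a = ·-zeroʳ (q^ (2 ℕ.* i))

Z-dilate : ∀ N a b c t₁ t₂ t₃ t₄ i j →
  Z N a b (2 ℕ.* a ℕ.+ c) (2 ℕ.+ t₁) (2 ℕ.+ t₂) t₃ (4 ℕ.+ t₄) i j ≗
  q^ (2 ℕ.* i) · Z N a b c t₁ t₂ t₃ t₄ i j
Z-dilate N a b c t₁ t₂ t₃ t₄ i j k = sym (trans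
  (·-Σ⁴ N (q^ (2 ℕ.* i)) (λ n₁ n₂ n₃ n₄ → summand a b c t₁ t₂ t₃ t₄ n₁ n₂ n₃ n₄ i j) k)
  (Σ⁴-cong N λ n₁ n₂ n₃ n₄ → trans
    (prod-·ˡ (q^ (2 ℕ.* i))
      (mono (xExp a n₁ n₂ n₄) (yExp b n₂ n₃) (qExp c t₁ t₂ t₃ t₄ n₁ n₂ n₃ n₄) i j)
      (invPoch₀ 2 n₁) (invPoch₀ 2 n₂) (invPoch₀ 4 n₃) (invPoch₀ 4 n₄) k)
    (prod-congˡ (invPoch₀ 2 n₁) (invPoch₀ 2 n₂) (invPoch₀ 4 n₃) (invPoch₀ 4 n₄) (≗-trans
      (q^-·-mono-x (xExp a n₁ n₂ n₄) (yExp b n₂ n₃) (qExp c t₁ t₂ t₃ t₄ n₁ n₂ n₃ n₄) i j)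
      (mono-cong refl refl (qExp-dilate a c t₁ t₂ t₃ t₄ n₁ n₂ n₃ n₄ (n₁ C 2)) i j)) k)))

-- The functional equation of S and its solution

S : (N i j : ℕ) → Series
S N i j = Z N 0 0 0 1 3 2 2 i j ⊞ Z N 2 1 4 5 3 6 2 i j

-- In `sum4` the cutoff is the exponent being read off, hence N = k.
RHS-coefficient : ∀ i j k → RHS i j k ≡ S k i j k
RHS-coefficient i j k = trans
  (Σ⁴-cong k λ n₁ n₂ n₃ n₄ → term-coefficient n₁ n₂ n₃ n₄ i j k)
  (Σ⁴-+ k (λ n₁ n₂ n₃ n₄ → summand 0 0 0 1 3 2 2 n₁ n₂ n₃ n₄ i j k)
    (λ n₁ n₂ n₃ n₄ → summand 2 1 4 5 3 6 2 n₁ n₂ n₃ n₄ i j k))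

-- The first bracket is the coefficient of xq S(x). The second is that of S(xq²), with t₁, t₂, t₄
-- raised by 2, 2, 4 and c by 2a.
S-functional : ∀ N i j →
  S N i j ≈[ N ] (Z N 1 0 1 1 3 2 2 i j ⊞ Z N 3 1 5 5 3 6 2 i j) ⊞
                 (Z N 0 0 0 3 5 2 6 i j ⊞ Z N 2 1 8 7 5 6 6 i j)
S-functional N i j k k≤N = combine-contiguous {n = Z N 0 0 0 3 5 2 6 i j k}
  -- The expansions of S(x) and xq S(x) share xq T(3,5,6,2), x²q² T(3,5,6,2) and xyq³ T(7,3,2,6);
  -- what is left over is S(xq²).
  (Contiguous.Z-contiguous₁ N 0 0 0 1 3 2 2 i j k k≤N)
  (Contiguous.Z-contiguous₁ N 1 0 1 1 3 2 2 i j k k≤N)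
  (Contiguous.Z-contiguous₁ N 1 1 3 5 3 2 6 i j k k≤N)
  (Contiguous.Z-contiguous₂ N 0 0 0 3 3 2 6 i j k k≤N)
  (Contiguous.Z-contiguous₂ N 1 0 1 3 3 6 2 i j k k≤N)
  (Contiguous.Z-contiguous₂ N 2 0 2 3 3 6 2 i j k k≤N)
  (Contiguous.Z-contiguous₃ N 1 0 1 3 3 2 2 i j k k≤N)
  (Contiguous.Z-contiguous₄ N 0 0 0 3 3 2 2 i j k k≤N)

S-suc : ∀ N i j → S N (suc i) j ≈[ N ] q^ 1 · S N i j ⊞ q^ (2 ℕ.* suc i) · S N (suc i) j
S-suc N i j k k≤N = trans (S-functional N (suc i) j k k≤N) (cong₂ ℤ._+_
  (trans
    (cong₂ ℤ._+_ (Z-xq-shift N 0 0 0 1 3 2 2 i j k) (Z-xq-shift N 2 1 4 5 3 6 2 i j k))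
    (sym (·-distribˡ (q^ 1) (Z N 0 0 0 1 3 2 2 i j) (Z N 2 1 4 5 3 6 2 i j) k)))
  (trans
    (cong₂ ℤ._+_ (Z-dilate N 0 0 0 1 3 2 2 (suc i) j k) (Z-dilate N 2 1 4 5 3 6 2 (suc i) j k))
    (sym (·-distribˡ (q^ (2 ℕ.* suc i)) (Z N 0 0 0 1 3 2 2 (suc i) j) (Z N 2 1 4 5 3 6 2 (suc i) j) k))))
  where open CommutativeSemiring series-commutativeSemiring using () renaming (distribˡ to ·-distribˡ)

-- The power x⁰ forces n₁ = n₂ = n₄ = 0 and excludes the half of S with the factor x²; then y^j
-- forces n₃ = j.
S-zero : ∀ N j → S N 0 j ≈[ N ] q^ (2 ℕ.* j) · invPoch₀ 4 j
S-zero N j k k≤N = begin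
  S N 0 j k
    ≡⟨ cong₂ ℤ._+_ only-n₃ (sumTo-zero N λ n₁ _ → sumTo-zero N λ n₂ _ → sumTo-zero N λ n₃ _ →
         sumTo-zero N λ n₄ _ →
         prod-zeroˡ (invPoch₀ 2 n₁) (invPoch₀ 2 n₂) (invPoch₀ 4 n₃) (invPoch₀ 4 n₄) ≗-refl k) ⟩
  sumTo N (λ n₃ → T n₃) ℤ.+ + 0
    ≡⟨ ℤₚ.+-identityʳ (sumTo N T) ⟩
  sumTo N T
    ≡⟨ only-j (ℕₚ.<-≤-connex N j) ⟩
  (q^ (2 ℕ.* j) · invPoch₀ 4 j) k ∎
  where
  open ≡-Reasoning
  T : ℕ → ℤ
  T n₃ = summand 0 0 0 1 3 2 2 0 0 n₃ 0 0 j k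
  only-n₃ : Z N 0 0 0 1 3 2 2 0 j k ≡ sumTo N T
  only-n₃ = trans
    (sumTo-head N λ n₁ → sumTo-zero N λ n₂ _ → sumTo-zero N λ n₃ _ → sumTo-zero N λ n₄ _ →
      prod-zeroˡ (invPoch₀ 2 (suc n₁)) (invPoch₀ 2 n₂) (invPoch₀ 4 n₃) (invPoch₀ 4 n₄) ≗-refl k)
    (trans
      (sumTo-head N λ n₂ → sumTo-zero N λ n₃ _ → sumTo-zero N λ n₄ _ →
        prod-zeroˡ (q^ 0) (invPoch₀ 2 (suc n₂)) (invPoch₀ 4 n₃) (invPoch₀ 4 n₄) ≗-refl k)
      (sumTo-cong N λ n₃ → sumTo-head N λ n₄ →
        prod-zeroˡ (q^ 0) (q^ 0) (invPoch₀ 4 n₃) (invPoch₀ 4 (suc n₄)) ≗-refl k))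
  T-zero : ∀ n₃ → n₃ ≢ j → T n₃ ≡ + 0
  T-zero n₃ n₃≢j = prod-zeroˡ (q^ 0) (q^ 0) (invPoch₀ 4 n₃) (q^ 0)
    (λ k → cong (λ b → ind (b ∧ (k ≡ᵇ qExp 0 1 3 2 2 0 0 n₃ 0))) (≢⇒≡ᵇ-false (≢-sym n₃≢j))) k
  T-j : T j ≡ (q^ (2 ℕ.* j) · invPoch₀ 4 j) k
  T-j = trans
    (prod-congˡ (q^ 0) (q^ 0) (invPoch₀ 4 j) (q^ 0) (λ k →
      cong₂ (λ b e → ind (b ∧ (k ≡ᵇ e))) (≡ᵇ-refl j) (base-exponent j)) k)
    (solve 2 (λ m r → m :* con 1 :* con 1 :* r :* con 1 := m :* r) ≗-refl
      (q^ (2 ℕ.* j)) (invPoch₀ 4 j) k)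
  only-j : N < j ⊎ j ≤ N → sumTo N T ≡ (q^ (2 ℕ.* j) · invPoch₀ 4 j) k
  -- The index j lies beyond the cutoff, but q^{2j} has no coefficient at k ≤ N < j either.
  only-j (inj₁ N<j) = trans
    (sumTo-zero N λ n₃ n₃≤N → T-zero n₃ (ℕₚ.<⇒≢ (ℕₚ.≤-<-trans n₃≤N N<j)))
    (sym (q^-·-low (2 ℕ.* j) (invPoch₀ 4 j)
      (ℕₚ.<-≤-trans (ℕₚ.≤-<-trans k≤N N<j) (ℕₚ.m≤n*m j 2))))
  only-j (inj₂ j≤N) = trans (sumTo-single j≤N T-zero) T-j

-- Induction on i: the functional equation and `q^-invPoch₀-rec` at e = 1, d = 2 give both sides the
-- same fixed-point equation with multiplier q^{2(i+1)}.
S-closed : ∀ N i j → S N i j ≈[ N ] (q^ (1 ℕ.* i) · invPoch₀ 2 i) · (q^ (2 ℕ.* j) · invPoch₀ 4 j)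
S-closed N zero    j k k≤N = trans (S-zero N j k k≤N) (sym (trans
  (·-congʳ y (·-identityˡ (q^ 0)) k) (·-identityˡ y k)))
  where
  y = q^ (2 ℕ.* j) · invPoch₀ 4 j
S-closed N (suc i) j = q^-fixpoint-unique (2 ℕ.* suc i)
  (·-cong≤ {f = q^ 1} {g = S N i j} (λ _ _ → refl) (S-closed N i j))
  (S-suc N i j)
  (λ k _ → trans (·-congʳ y (q^-invPoch₀-rec 1 2 i) k)
    (solve 5 (λ u v w p y → (u :* v :+ w :* p) :* y := u :* (v :* y) :+ w :* (p :* y)) ≗-refl
      (q^ 1) (q^ (1 ℕ.* i) · invPoch₀ 2 i) (q^ (2 ℕ.* suc i))
      (q^ (1 ℕ.* suc i) · invPoch₀ 2 (suc i)) y k))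
  where
  y = q^ (2 ℕ.* j) · invPoch₀ 4 j

theorem3p1 : LHS ≐ RHS
theorem3p1 i j k = trans (LHS-coefficient i j k)
  (sym (trans (RHS-coefficient i j k) (S-closed k i j k ℕₚ.≤-refl)))
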